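{- Let $D$ be a decidable domain presented by a language $L$, let $L^{+}$ adjoin the parametrised gate $\mathrm{ask}(\cdot)$, and let $(a_k)_{k\in\mathbb{N}}$ be the iterates. Suppose $|Q^{*}(p)|=n<\infty$. Then the sequence $(a_k(p))_{k\in\mathbb{N}}$ is eventually periodic, with transient plus period at most $2^n$; the eventual period is computable from $\nu(p)$; and the bound is essentially attained: for infinitely many $n$ there is a system $\nu(p)$ of the re-entry language (with the parametrised gate adjoined) with $|Q^{*}(p)|=n$ whose sequence $(a_k(p))_k$ has period $2^n-1$.
   Context: A domain $D$ presented by a language $L$ with a computable numbering of its systems has a manifestation predicate; it is decidable if it is decidable whether a given system manifests. $L^{+}$ is obtained from $L$ by adjoining a gate $\mathrm{ask}(q)$ with a parameter $q\in\mathbb{N}$; $L^+$ is a decidable set of finite syntactic objects with a fixed computable numbering $\nu:\mathbb{N}\to L^{+}$ extending that of $L$. Assigning a value in $\{0,1\}=\{\text{void},\text{mark}\}$ to every occurring gate turns a system of $L^+$ into a gate-free system of $L$, which is evaluated as in $L$. Iterates: $a_0(p)=0$ for all $p$; $a_{k+1}(p)=1$ if the system $\nu(p)$, evaluated with each occurrence of $\mathrm{ask}(q)$ returning $a_k(q)$, fails to manifest, and $a_{k+1}(p)=0$ otherwise. $Q(p)=\{q:\mathrm{ask}(q)\text{ occurs in }\nu(p)\}$, and $Q^{*}(p)$ is the closure of $\{p\}$ under $Q$ (the smallest set containing $p$ and containing $Q(q)$ whenever it contains $q$). Re-entry language: over $\{\text{void},\text{mark}\}=\{0,1\}$, crossing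 is negation and juxtaposition is disjunction. A (finite-state) re-entry system consists of finitely many state variables, each updated synchronously by an expression built from the state variables by crossing and juxtaposition, evolving from its initial state, with one designated observed coordinate; it manifests iff the observed coordinate takes the value mark at some time. In $L^{+}$ the expressions may additionally contain gates $\mathrm{ask}(q)$. This domain is decidable.
   Formalization: In the sharpness clause the numbering ν of the re-entry language with gates is chosen (one computable numbering serving infinitely many n) rather than given: for a numbering in which each system's index exceeds its gate parameters, every sequence has eventual period 1 and the clause fails. -}

module Defs where

open import Data.Bool using (Bool; true; false; not; _∨_; if_then_else_)
open import Data.Empty using (⊥)
open import Data.Fin using (Fin; toℕ)
open import Data.Fin.Properties using (toℕ-injective)
open import Data.List using (List; []; _∷_; _++_; length)
open import Data.List.Membership.Propositional using (_∈_)
open import Data.List.Membership.Propositional.Properties using (∈-++⁺ˡ; ∈-++⁺ʳ)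
open import Data.List.Relation.Unary.Any using (here)
open import Data.List.Relation.Unary.Unique.Propositional using (Unique)
open import Data.Nat using (ℕ; zero; suc; _+_; _≤_; _<_; _≟_)
open import Data.List.Membership.DecPropositional _≟_ using (_∈?_)
open import Data.Product using (Σ; Σ-syntax; ∃; ∃-syntax; _×_; _,_; proj₁; proj₂)
open import Data.Sum using (_⊎_; inj₁; inj₂)
open import Data.Vec using (Vec; []; _∷_; lookup; map)
open import Function using (id; _∘_; _⇔_; Injective; Surjective)
open import Relation.Binary.PropositionalEquality
  using (_≡_; refl; cong; cong₂)
open import Relation.Nullary using (¬_; Dec; yes; no; does)

-- Computability: partial recursive functions on ℕ, extended to lists,
-- pairs and labelled binary trees so that finite syntactic objects need
-- no Gödel numbering.  Restricted to ℕ these are the usual partial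
-- recursive functions.

data Tree : Set where
  leaf : Tree
  node : ℕ → Tree → Tree → Tree

infixr 5 _⊗_

data Sort : Set where
  nat tree : Sort
  list     : Sort → Sort
  _⊗_      : Sort → Sort → Sort

Val : Sort → Set
Val nat      = ℕ
Val tree     = Tree
Val (list σ) = List (Val σ)
Val (σ ⊗ τ)  = Val σ × Val τ

infixr 9 _∙_

data Code : Sort → Sort → Set where
  idC       : ∀ {σ} → Code σ σ
  _∙_       : ∀ {ρ σ τ} → Code σ τ → Code ρ σ → Code ρ τ
  pairC     : ∀ {ρ σ τ} → Code ρ σ → Code ρ τ → Code ρ (σ ⊗ τ)
  fstC      : ∀ {σ τ} → Code (σ ⊗ τ) σ
  sndC      : ∀ {σ τ} → Code (σ ⊗ τ) τ
  zeroC     : ∀ {σ} → Code σ nat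
  sucC      : Code nat nat
  nilC      : ∀ {σ τ} → Code σ (list τ)
  consC     : ∀ {σ} → Code (σ ⊗ list σ) (list σ)
  leafC     : ∀ {σ} → Code σ tree
  nodeC     : Code (nat ⊗ tree ⊗ tree) tree
  natRecC   : ∀ {σ τ} → Code σ τ → Code (σ ⊗ nat ⊗ τ) τ → Code (σ ⊗ nat) τ
  listRecC  : ∀ {ρ σ τ} → Code ρ τ → Code (ρ ⊗ σ ⊗ list σ ⊗ τ) τ →
              Code (ρ ⊗ list σ) τ
  treeRecC  : ∀ {σ τ} → Code σ τ →
              Code (σ ⊗ nat ⊗ (tree ⊗ tree) ⊗ (τ ⊗ τ)) τ →
              Code (σ ⊗ tree) τ
  muC       : ∀ {σ} → Code (σ ⊗ nat) nat → Code σ nat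

-- Graphs of the functions defined by recursion on the second component,
-- from the graphs of the base case and of the step.

NatRec : {A B : Set} → (A → B → Set) → (A × ℕ × B → B → Set) →
         A → ℕ → B → Set
NatRec G H x zero    y = G x y
NatRec G H x (suc n) y = ∃[ u ] (NatRec G H x n u × H (x , n , u) y)

ListRec : {A B C : Set} → (A → B → Set) → (A × C × List C × B → B → Set) →
          A → List C → B → Set
ListRec G H x []       y = G x y
ListRec G H x (c ∷ cs) y = ∃[ u ] (ListRec G H x cs u × H (x , c , cs , u) y)

TreeRec : {A B : Set} → (A → B → Set) →
          (A × ℕ × (Tree × Tree) × (B × B) → B → Set) →
          A → Tree → B → Set
TreeRec G H x leaf         y = G x y
TreeRec G H x (node n l r) y =
  ∃[ u ] ∃[ v ] (TreeRec G H x l u × TreeRec G H x r v ×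
                 H (x , n , (l , r) , (u , v)) y)

-- ⟦ c ⟧ x y : the program c halts on input x with output y.

⟦_⟧ : ∀ {σ τ} → Code σ τ → Val σ → Val τ → Set
⟦ idC ⟧          x       y = y ≡ x
⟦ d ∙ c ⟧        x       z = ∃[ y ] (⟦ c ⟧ x y × ⟦ d ⟧ y z)
⟦ pairC c d ⟧    x (y , z) = ⟦ c ⟧ x y × ⟦ d ⟧ x z
⟦ fstC ⟧         x       y = y ≡ proj₁ x
⟦ sndC ⟧         x       y = y ≡ proj₂ x
⟦ zeroC ⟧        x       y = y ≡ 0
⟦ sucC ⟧         x       y = y ≡ suc x
⟦ nilC ⟧         x       y = y ≡ []
⟦ consC ⟧        (x , xs) y = y ≡ x ∷ xs
⟦ leafC ⟧        x       y = y ≡ leaf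
⟦ nodeC ⟧   (n , l , r)  y = y ≡ node n l r
⟦ natRecC c d ⟧  (x , n) y = NatRec ⟦ c ⟧ ⟦ d ⟧ x n y
⟦ listRecC c d ⟧ (x , w) y = ListRec ⟦ c ⟧ ⟦ d ⟧ x w y
⟦ treeRecC c d ⟧ (x , t) y = TreeRec ⟦ c ⟧ ⟦ d ⟧ x t y
⟦ muC c ⟧        x       n =
  ⟦ c ⟧ (x , n) 0 × (∀ m → m < n → ∃[ k ] ⟦ c ⟧ (x , m) (suc k))

Computable : {A : Set} (σ τ : Sort) → (A → Val σ) → (A → Val τ) → Set
Computable σ τ enc g = Σ[ c ∈ Code σ τ ] (∀ x → ⟦ c ⟧ (enc x) (g x))

-- Some program, halting on the representation of every x, answers whether
-- P x holds.

DecidableBy : {A : Set} (σ : Sort) → (A → Val σ) → (A → Set) → Set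
DecidableBy σ enc P =
  Σ[ c ∈ Code σ nat ]
    (∀ x → (P x × ⟦ c ⟧ (enc x) 1) ⊎ (¬ P x × ⟦ c ⟧ (enc x) 0))

-- Throughout, false is void (0) and true is mark (1).

record Domain : Set₁ where
  field
    L         : Set
    Manifests : L → Set
    L⁺        : Set
    ⌜_⌝       : L⁺ → Tree
    ⌜⌝-inj    : Injective _≡_ _≡_ ⌜_⌝
    -- the parameters q such that ask(q) occurs
    gates     : L⁺ → List ℕ
    -- replaces each ask(q) by the value assigned to q
    fill      : L⁺ → (ℕ → Bool) → L
    fill-cong : ∀ s f g → (∀ q → q ∈ gates s → f q ≡ g q) →
                fill s f ≡ fill s g
    embed       : L → L⁺
    gates-embed : ∀ s → gates (embed s) ≡ []
    fill-embed  : ∀ s f → fill (embed s) f ≡ s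

-- The assignment with value mark exactly at the members of M; every
-- assignment to the finitely many gates of a system is of this form.

marks : List ℕ → ℕ → Bool
marks M q = does (q ∈? M)

record Presentation (D : Domain) : Set where
  open Domain D
  field
    L⁺-decidable   : DecidableBy tree id (λ t → ∃[ s ] ⌜ s ⌝ ≡ t)
    gates-comp     : Computable tree (list nat) ⌜_⌝ gates
    fill-comp      : Computable {L⁺ × List ℕ} (tree ⊗ list nat) tree
                       (λ (s , M) → ⌜ s ⌝ , M)
                       (λ (s , M) → ⌜ embed (fill s (marks M)) ⌝)
    ν₀             : ℕ → L
    ν₀-surjective  : Surjective _≡_ _≡_ ν₀
    ν₀-comp        : Computable nat tree id (λ e → ⌜ embed (ν₀ e) ⌝)
    ν              : ℕ → L⁺
    ν-surjective   : Surjective _≡_ _≡_ ν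
    ν-comp         : Computable nat tree id (λ p → ⌜ ν p ⌝)
    -- ν extends ν₀: each L-index is effectively also an L⁺-index
    index          : ℕ → ℕ
    index-comp     : Computable nat nat id index
    ν-extends      : ∀ e → ν (index e) ≡ embed (ν₀ e)

Decidable : Domain → Set
Decidable D = DecidableBy tree (λ s → ⌜ embed s ⌝) Manifests
  where open Domain D

manifests? : (D : Domain) → Decidable D → ∀ s → Dec (Domain.Manifests D s)
manifests? D (_ , ans) s with ans s
... | inj₁ (m , _)  = yes m
... | inj₂ (¬m , _) = no ¬m

module _ {D : Domain} (P : Presentation D) where
  open Domain D
  open Presentation P

  Q : ℕ → List ℕ
  Q p = gates (ν p)

  data Q* (p : ℕ) : ℕ → Set where
    base : Q* p p
    step : ∀ {q r} → Q* p q → r ∈ Q q → Q* p r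

  iterates : Decidable D → ℕ → ℕ → Bool
  iterates dec zero    p = false
  iterates dec (suc k) p =
    not (does (manifests? D dec (fill (ν p) (iterates dec k))))

HasSize : (ℕ → Set) → ℕ → Set
HasSize A n =
  Σ[ xs ∈ List ℕ ] (Unique xs × length xs ≡ n × (∀ q → q ∈ xs ⇔ A q))

PeriodicFrom : (ℕ → Bool) → ℕ → ℕ → Set
PeriodicFrom s t π = 0 < π × (∀ k → t ≤ k → s (k + π) ≡ s k)

EventualPeriod : (ℕ → Bool) → ℕ → Set
EventualPeriod s π =
  (∃[ t ] PeriodicFrom s t π) × (∀ t′ π′ → PeriodicFrom s t′ π′ → π ≤ π′)

-- t is the transient of a sequence whose eventual period is π.

Transient : (ℕ → Bool) → ℕ → ℕ → Set
Transient s π t = PeriodicFrom s t π × (∀ t′ → PeriodicFrom s t′ π → t ≤ t′)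

-- The re-entry language.  G is the type of gate parameters: ⊥ for L, ℕ for
-- L⁺.  The constant void is the empty juxtaposition; it is needed for
-- filled-in gates to be expressions of L.

data Expr (G : Set) (m : ℕ) : Set where
  void  : Expr G m
  var   : Fin m → Expr G m
  cross : Expr G m → Expr G m
  juxt  : Expr G m → Expr G m → Expr G m
  ask   : G → Expr G m

record System (G : Set) : Set where
  constructor system
  field
    {size}   : ℕ
    observed : Fin size
    init     : Vec Bool size
    update   : Vec (Expr G size) size

eval : ∀ {m} → Vec Bool m → Expr ⊥ m → Bool
eval v void       = false
eval v (var i)    = lookup v i
eval v (cross e)  = not (eval v e)
eval v (juxt e f) = eval v e ∨ eval v f

state : (S : System ⊥) → ℕ → Vec Bool (System.size S)
state S zero    = System.init S
state S (suc t) = map (eval (state S t)) (System.update S)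

Marks : System ⊥ → Set
Marks S = ∃[ t ] lookup (state S t) (System.observed S) ≡ true

substE : ∀ {G H m} → (∀ {k} → G → Expr H k) → Expr G m → Expr H m
substE f void        = void
substE f (var i)     = var i
substE f (cross e)   = cross (substE f e)
substE f (juxt e e′) = juxt (substE f e) (substE f e′)
substE f (ask q)     = f q

substS : ∀ {G H} → (∀ {k} → G → Expr H k) → System G → System H
substS f (system o i u) = system o i (map (substE f) u)

const : ∀ {G m} → Bool → Expr G m
const false = void
const true  = cross void

fillR : System ℕ → (ℕ → Bool) → System ⊥
fillR S a = substS (λ q → const (a q)) S

embedR : System ⊥ → System ℕ
embedR = substS λ ()

gatesE : ∀ {m} → Expr ℕ m → List ℕ
gatesE void       = []
gatesE (var i)    = []
gatesE (cross e)  = gatesE e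
gatesE (juxt e f) = gatesE e ++ gatesE f
gatesE (ask q)    = q ∷ []

gatesV : ∀ {m k} → Vec (Expr ℕ m) k → List ℕ
gatesV []      = []
gatesV (e ∷ u) = gatesE e ++ gatesV u

gatesR : System ℕ → List ℕ
gatesR S = gatesV (System.update S)

numeral : ℕ → Tree
numeral k = node k leaf leaf

codeE : ∀ {m} → Expr ℕ m → Tree
codeE void       = leaf
codeE (cross e)  = node 0 (codeE e) leaf
codeE (juxt e f) = node 1 (codeE e) (codeE f)
codeE (var i)    = node 2 (numeral (toℕ i)) leaf
codeE (ask q)    = node 3 (numeral q) leaf

codeV : ∀ {m k} → Vec Bool k → Vec (Expr ℕ m) k → Tree
codeV []      []      = leaf
codeV (b ∷ i) (e ∷ u) = node (if b then 5 else 4) (codeE e) (codeV i u)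

codeR : System ℕ → Tree
codeR (system o i u) = node 6 (numeral (toℕ o)) (codeV i u)

private

  label : Tree → ℕ
  label leaf         = 0
  label (node n _ _) = n

  left right : Tree → Tree
  left leaf          = leaf
  left (node _ l _)  = l
  right leaf         = leaf
  right (node _ _ r) = r

  codeE-inj : ∀ {m} (e f : Expr ℕ m) → codeE e ≡ codeE f → e ≡ f
  codeE-inj void void p = refl
  codeE-inj (var i) (var j) p = cong var (toℕ-injective (cong (label ∘ left) p))
  codeE-inj (cross e) (cross f) p = cong cross (codeE-inj e f (cong left p))
  codeE-inj (juxt e e′) (juxt f f′) p =
    cong₂ juxt (codeE-inj e f (cong left p)) (codeE-inj e′ f′ (cong right p))
  codeE-inj (ask q) (ask r) p = cong ask (cong (label ∘ left) p)

  codeV-size : ∀ {m m′ k k′} (i : Vec Bool k) (u : Vec (Expr ℕ m) k)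
               (i′ : Vec Bool k′) (u′ : Vec (Expr ℕ m′) k′) →
               codeV i u ≡ codeV i′ u′ → k ≡ k′
  codeV-size [] [] [] [] p = refl
  codeV-size [] [] (_ ∷ _) (_ ∷ _) ()
  codeV-size (_ ∷ _) (_ ∷ _) [] [] ()
  codeV-size (_ ∷ i) (_ ∷ u) (_ ∷ i′) (_ ∷ u′) p =
    cong suc (codeV-size i u i′ u′ (cong right p))

  bit-inj : ∀ b c → (if b then 5 else 4) ≡ (if c then 5 else 4) → b ≡ c
  bit-inj false false p = refl
  bit-inj true  true  p = refl

  codeV-inj : ∀ {m k} (i : Vec Bool k) (u : Vec (Expr ℕ m) k) i′ u′ →
              codeV i u ≡ codeV i′ u′ → i ≡ i′ × u ≡ u′
  codeV-inj [] [] [] [] p = refl , refl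
  codeV-inj (b ∷ i) (e ∷ u) (c ∷ i′) (f ∷ u′) p
    with codeV-inj i u i′ u′ (cong right p)
  ... | q , r = cong₂ _∷_ (bit-inj b c (cong label p)) q ,
                cong₂ _∷_ (codeE-inj e f (cong left p)) r

  codeR-inj : ∀ {S T} → codeR S ≡ codeR T → S ≡ T
  codeR-inj {system o i u} {system o′ i′ u′} p
    with codeV-size i u i′ u′ (cong right p)
  ... | refl with toℕ-injective {i = o} {j = o′} (cong (label ∘ left) p)
                | codeV-inj i u i′ u′ (cong right p)
  ... | refl | refl , refl = refl

  fillE-cong : ∀ {m} (e : Expr ℕ m) (f g : ℕ → Bool) →
               (∀ q → q ∈ gatesE e → f q ≡ g q) →
               substE {H = ⊥} (λ q → const (f q)) e ≡
               substE (λ q → const (g q)) e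
  fillE-cong void       f g h = refl
  fillE-cong (var i)    f g h = refl
  fillE-cong (cross e)  f g h = cong cross (fillE-cong e f g h)
  fillE-cong (juxt e e′) f g h =
    cong₂ juxt (fillE-cong e f g (λ q → h q ∘ ∈-++⁺ˡ))
               (fillE-cong e′ f g (λ q → h q ∘ ∈-++⁺ʳ (gatesE e)))
  fillE-cong (ask q)    f g h = cong const (h q (here refl))

  fillV-cong : ∀ {m k} (u : Vec (Expr ℕ m) k) (f g : ℕ → Bool) →
               (∀ q → q ∈ gatesV u → f q ≡ g q) →
               map (substE {H = ⊥} (λ q → const (f q))) u ≡
               map (substE (λ q → const (g q))) u
  fillV-cong []      f g h = refl
  fillV-cong (e ∷ u) f g h =
    cong₂ _∷_ (fillE-cong e f g (λ q → h q ∘ ∈-++⁺ˡ))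
              (fillV-cong u f g (λ q → h q ∘ ∈-++⁺ʳ (gatesE e)))

  gatesE-embed : ∀ {m} (e : Expr ⊥ m) → gatesE (substE (λ ()) e) ≡ []
  gatesE-embed void       = refl
  gatesE-embed (var i)    = refl
  gatesE-embed (cross e)  = gatesE-embed e
  gatesE-embed (juxt e f) = cong₂ _++_ (gatesE-embed e) (gatesE-embed f)

  gatesV-embed : ∀ {m k} (u : Vec (Expr ⊥ m) k) →
                 gatesV (map (substE (λ ())) u) ≡ []
  gatesV-embed []      = refl
  gatesV-embed (e ∷ u) = cong₂ _++_ (gatesE-embed e) (gatesV-embed u)

  fillE-embed : ∀ {m} (e : Expr ⊥ m) (f : ℕ → Bool) →
                substE (λ q → const (f q)) (substE (λ ()) e) ≡ e
  fillE-embed void        f = refl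
  fillE-embed (var i)     f = refl
  fillE-embed (cross e)   f = cong cross (fillE-embed e f)
  fillE-embed (juxt e e′) f = cong₂ juxt (fillE-embed e f) (fillE-embed e′ f)

  fillV-embed : ∀ {m k} (u : Vec (Expr ⊥ m) k) (f : ℕ → Bool) →
                map (substE (λ q → const (f q))) (map (substE (λ ())) u) ≡ u
  fillV-embed []      f = refl
  fillV-embed (e ∷ u) f = cong₂ _∷_ (fillE-embed e f) (fillV-embed u f)

ReEntry : Domain
ReEntry = record
  { L           = System ⊥
  ; Manifests   = Marks
  ; L⁺          = System ℕ
  ; ⌜_⌝         = codeR
  ; ⌜⌝-inj      = codeR-inj
  ; gates       = gatesR
  ; fill        = fillR
  ; fill-cong   = λ S f g h →
      cong (system (System.observed S) (System.init S))
           (fillV-cong (System.update S) f g h)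
  ; embed       = embedR
  ; gates-embed = λ S → gatesV-embed (System.update S)
  ; fill-embed  = λ S f →
      cong (system (System.observed S) (System.init S))
           (fillV-embed (System.update S) f)
  }

{-# OPTIONS --safe #-}

-- If X is a finite set of indices closed under Q, the values of the iterates
-- on X at one stage determine those at the next, so by the pigeonhole
-- principle they repeat within 2 ^ |X| stages.  A program cannot be told n,
-- but it can enumerate the indices reachable from ν(p) until they are
-- closed, which bounds transient plus period; the least shift that fixes a
-- window beyond this bound is then the eventual period.
--
-- For sharpness the numbering of the re-entry language is chosen with blocks
-- of mutually referring systems at known indices: block d is a counter with
-- d + 1 bits that skips the all-ones state.  Its top bit is void for 2 ^ d
-- stages and mark for 2 ^ d - 1, and no shorter shift preserves this pattern.

module Submission where

open import Data.Bool using (Bool; true; false; not; _∧_; _∨_; if_then_else_; T)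
open import Data.Bool.Properties using (T-≡; T-∧; T?; not-involutive)
  renaming (_≟_ to _≟ᵇ_)
open import Data.Empty using (⊥; ⊥-elim)
open import Data.Fin using (Fin; zero; suc; toℕ; fromℕ<; funToFin; finToFun)
open import Data.Fin.Properties
  using (pigeonhole; finToFun-funToFin; toℕ<n; toℕ-fromℕ<)
open import Data.List
  using (List; []; _∷_; _++_; length; concatMap; filterᵇ; lookup; applyUpTo)
open import Data.List.Membership.Propositional using (_∈_; find)
open import Data.List.Membership.Propositional.Properties
open import Data.List.Properties using (++-identityʳ; length-applyUpTo)
open import Data.List.Relation.Unary.Any as Any using (here; there; index)
open import Data.List.Relation.Unary.Any.Properties using (lookup-index)
open import Data.List.Relation.Unary.Unique.Propositional.Properties
  using (applyUpTo⁺₁)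
open import Data.Nat
open import Data.Nat.Induction using (<-wellFounded; Acc; acc)
open import Data.Nat.Properties
open import Algebra.Properties.CommutativeSemigroup +-commutativeSemigroup
  using (xy∙z≈xz∙y)
open import Algebra.Properties.CommutativeSemigroup *-commutativeSemigroup
  using (x∙yz≈y∙xz)
open import Data.List.Membership.DecPropositional _≟_ using (_∈?_)
open import Data.Product using (Σ-syntax; ∃-syntax; _×_; _,_; proj₁; proj₂)
open import Data.Sum using (_⊎_; inj₁; inj₂; [_,_]′; map₂)
open import Data.Unit using (tt)
open import Data.Vec using (Vec; []; _∷_)
  renaming (map to mapᵛ; lookup to lookupᵛ)
open import Data.Vec.Properties using (tabulate∘lookup; tabulate-cong)
open import Function using (id; _∘_; case_of_; Equivalence; mk⇔)
open import Relation.Binary.PropositionalEquality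
  using (_≡_; refl; sym; trans; cong; cong₂; subst; _≗_; module ≡-Reasoning)
open import Relation.Nullary using (¬_; Dec; yes; no; does)
open import Relation.Nullary.Decidable using (dec-true; dec-false)
open import Defs

-- Programs for total functions on represented sets

-- The program receives the code of `ν p`, and `ν` need not be injective, so `p` cannot be read off.
-- Hence the enumeration starts from the gates of `ν p`, where `p` may or may not turn up, and only
-- iterates of positive stage are computed: these are determined by `ν p` and the previous values at
-- its gates. An assignment is handed to a program as the list of its marked indices within a closed
-- set. Finiteness of the closure is never input; it only guarantees that an unbounded search halts.
-- For sharpness a system has to mention its own index. Since the numbering is free to choose, these
-- indices are given by a formula and no fixed-point theorem is involved; what has to be checked
-- instead is that the numbering stays computable, surjective and an extension of that of the
-- gate-free systems. The stage `a 0`, constantly void, is the zero state of the counter, and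
-- removing one of its `2 ^ n` states gives the period `2 ^ n ∸ 1` exactly.

bit : Bool → ℕ
bit false = zero
bit true  = suc zero

-- `encode` may forget part of the carrier, such as a proof of finiteness, or add values computed
-- from it, as in the steps of a recursion.
record Rep : Set₁ where
  constructor rep
  field
    Carrier : Set
    sort    : Sort
    encode  : Carrier → Val sort

open Rep

record Program (Γ : Rep) (τ : Sort) (g : Carrier Γ → Val τ) : Set where
  constructor program
  field
    code : Code (sort Γ) τ
    runs : ∀ x → ⟦ code ⟧ (encode Γ x) (g x)

open Program

Test : (Γ : Rep) → (Carrier Γ → Bool) → Set
Test Γ b = Program Γ nat (λ x → bit (b x))

⟨_⟩ : Sort → Rep
⟨ σ ⟩ = rep (Val σ) σ id

infixl 4 _▹ℕ

_▹ℕ : Rep → Rep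
Γ ▹ℕ = rep (Carrier Γ × ℕ) (sort Γ ⊗ nat) (λ (x , n) → encode Γ x , n)

-- The contexts in which the step of a recursion runs: besides the data of
-- the step, the input holds the value of the function f being defined at
-- the substructures, so the defining equations of f need no separate proof.

natStep : (Γ : Rep) (τ : Sort) → (Carrier Γ → ℕ → Val τ) → Rep
natStep Γ τ f = rep (Carrier Γ × ℕ) (sort Γ ⊗ nat ⊗ τ)
                    (λ (x , n) → encode Γ x , n , f x n)

listStep : (Γ : Rep) (σ τ : Sort) → (Carrier Γ → List (Val σ) → Val τ) → Rep
listStep Γ σ τ f = rep (Carrier Γ × Val σ × List (Val σ))
                       (sort Γ ⊗ σ ⊗ list σ ⊗ τ)
                       (λ (x , c , cs) → encode Γ x , c , cs , f x cs)

treeStep : (Γ : Rep) (τ : Sort) → (Carrier Γ → Tree → Val τ) → Rep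
treeStep Γ τ f =
  rep (Carrier Γ × ℕ × Tree × Tree)
      (sort Γ ⊗ nat ⊗ (tree ⊗ tree) ⊗ (τ ⊗ τ))
      (λ (x , n , l , r) → encode Γ x , n , (l , r) , (f x l , f x r))

private variable
  Γ Δ : Rep
  ρ σ τ : Sort

convert : {g h : Carrier Γ → Val τ} → (∀ x → g x ≡ h x) →
          Program Γ τ g → Program Γ τ h
convert {Γ = Γ} e P .code = code P
convert {Γ = Γ} e P .runs x = subst (⟦ code P ⟧ (encode Γ x)) (e x) (runs P x)

-- Substitution of an argument. Only the encoding of `k x` is computed, so `k` may also produce
-- proofs.
run : {f : Carrier Δ → Val τ} → Program Δ τ f → (k : Carrier Γ → Carrier Δ) →
      Program Γ (sort Δ) (λ x → encode Δ (k x)) → Program Γ τ (λ x → f (k x))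
run P k R .code = code P ∙ code R
run P k R .runs x = _ , runs R x , runs P (k x)

input : Program Γ (sort Γ) (encode Γ)
input .code = idC
input .runs x = refl

pairP : {g : Carrier Γ → Val σ} {h : Carrier Γ → Val τ} →
        Program Γ σ g → Program Γ τ h → Program Γ (σ ⊗ τ) (λ x → g x , h x)
pairP P R .code = pairC (code P) (code R)
pairP P R .runs x = runs P x , runs R x

fstP : {g : Carrier Γ → Val (σ ⊗ τ)} → Program Γ (σ ⊗ τ) g →
       Program Γ σ (λ x → proj₁ (g x))
fstP = run (program {Γ = ⟨ _ ⟩} fstC (λ _ → refl)) _

sndP : {g : Carrier Γ → Val (σ ⊗ τ)} → Program Γ (σ ⊗ τ) g →
       Program Γ τ (λ x → proj₂ (g x))
sndP = run (program {Γ = ⟨ _ ⟩} sndC (λ _ → refl)) _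

sucP : {g : Carrier Γ → ℕ} → Program Γ nat g → Program Γ nat (λ x → suc (g x))
sucP = run (program {Γ = ⟨ _ ⟩} sucC (λ _ → refl)) _

litP : (n : ℕ) → Program Γ nat (λ _ → n)
litP zero = program zeroC (λ _ → refl)
litP (suc n) = sucP (litP n)

nilP : Program Γ (list τ) (λ _ → [])
nilP = program nilC (λ _ → refl)

leafP : Program Γ tree (λ _ → leaf)
leafP = program leafC (λ _ → refl)

consP : {g : Carrier Γ → Val τ} {h : Carrier Γ → List (Val τ)} →
        Program Γ τ g → Program Γ (list τ) h →
        Program Γ (list τ) (λ x → g x ∷ h x)
consP P R = run (program {Γ = ⟨ _ ⟩} consC (λ _ → refl)) _ (pairP P R)

nodeP : {g : Carrier Γ → ℕ} {h k : Carrier Γ → Tree} → Program Γ nat g →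
        Program Γ tree h → Program Γ tree k →
        Program Γ tree (λ x → node (g x) (h x) (k x))
nodeP P R S = run (program {Γ = ⟨ _ ⟩} nodeC (λ _ → refl)) _ (pairP P (pairP R S))

module _ {f : Carrier Γ → ℕ → Val τ} where

  natRecP : {k : Carrier Γ → ℕ} → Program Γ nat k →
            Program Γ τ (λ x → f x 0) →
            Program (natStep Γ τ f) τ (λ (x , n) → f x (suc n)) →
            Program Γ τ (λ x → f x (k x))
  natRecP {k} K P R .code = natRecC (code P) (code R) ∙ pairC idC (code K)
  natRecP {k} K P R .runs x = _ , (refl , runs K x) , rec (k x)
    where
    rec : ∀ n → NatRec ⟦ code P ⟧ ⟦ code R ⟧ (encode Γ x) n (f x n)
    rec zero    = runs P x
    rec (suc n) = f x n , rec n , runs R (x , n)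

  natPar : {g : Carrier Γ → Val ρ} → Program Γ ρ g →
           Program (natStep Γ τ f) ρ (λ (x , _) → g x)
  natPar P = run P proj₁ (fstP input)

  natIdx : Program (natStep Γ τ f) nat (λ (_ , n) → n)
  natIdx = fstP (sndP input)

  natVal : Program (natStep Γ τ f) τ (λ (x , n) → f x n)
  natVal = sndP (sndP input)

module _ {f : Carrier Γ → List (Val σ) → Val τ} where

  listRecP : {k : Carrier Γ → List (Val σ)} → Program Γ (list σ) k →
             Program Γ τ (λ x → f x []) →
             Program (listStep Γ σ τ f) τ (λ (x , c , cs) → f x (c ∷ cs)) →
             Program Γ τ (λ x → f x (k x))
  listRecP {k} K P R .code = listRecC (code P) (code R) ∙ pairC idC (code K)
  listRecP {k} K P R .runs x = _ , (refl , runs K x) , rec (k x)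
    where
    rec : ∀ w → ListRec ⟦ code P ⟧ ⟦ code R ⟧ (encode Γ x) w (f x w)
    rec []       = runs P x
    rec (c ∷ cs) = f x cs , rec cs , runs R (x , c , cs)

  listPar : {g : Carrier Γ → Val ρ} → Program Γ ρ g →
            Program (listStep Γ σ τ f) ρ (λ (x , _) → g x)
  listPar P = run P proj₁ (fstP input)

  listHead : Program (listStep Γ σ τ f) σ (λ (_ , c , _) → c)
  listHead = fstP (sndP input)

  listTail : Program (listStep Γ σ τ f) (list σ) (λ (_ , _ , cs) → cs)
  listTail = fstP (sndP (sndP input))

  listVal : Program (listStep Γ σ τ f) τ (λ (x , _ , cs) → f x cs)
  listVal = sndP (sndP (sndP input))

module _ {f : Carrier Γ → Tree → Val τ} where

  treeRecP : {k : Carrier Γ → Tree} → Program Γ tree k →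
             Program Γ τ (λ x → f x leaf) →
             Program (treeStep Γ τ f) τ (λ (x , n , l , r) → f x (node n l r)) →
             Program Γ τ (λ x → f x (k x))
  treeRecP {k} K P R .code = treeRecC (code P) (code R) ∙ pairC idC (code K)
  treeRecP {k} K P R .runs x = _ , (refl , runs K x) , rec (k x)
    where
    rec : ∀ t → TreeRec ⟦ code P ⟧ ⟦ code R ⟧ (encode Γ x) t (f x t)
    rec leaf         = runs P x
    rec (node n l r) = f x l , f x r , rec l , rec r , runs R (x , n , l , r)

  treePar : {g : Carrier Γ → Val ρ} → Program Γ ρ g →
            Program (treeStep Γ τ f) ρ (λ (x , _) → g x)
  treePar P = run P proj₁ (fstP input)

  treeLabel : Program (treeStep Γ τ f) nat (λ (_ , n , _) → n)
  treeLabel = fstP (sndP input)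

  treeLeft : Program (treeStep Γ τ f) tree (λ (_ , _ , l , _) → l)
  treeLeft = fstP (fstP (sndP (sndP input)))

  treeRight : Program (treeStep Γ τ f) tree (λ (_ , _ , _ , r) → r)
  treeRight = sndP (fstP (sndP (sndP input)))

  leftVal : Program (treeStep Γ τ f) τ (λ (x , _ , l , _) → f x l)
  leftVal = fstP (sndP (sndP (sndP input)))

  rightVal : Program (treeStep Γ τ f) τ (λ (x , _ , _ , r) → f x r)
  rightVal = sndP (sndP (sndP (sndP input)))

par : {g : Carrier Γ → Val ρ} → Program Γ ρ g →
      Program (Γ ▹ℕ) ρ (λ (x , _) → g x)
par P = run P proj₁ (fstP input)

idx : Program (Γ ▹ℕ) nat (λ (_ , n) → n)
idx = sndP input

Least : (ℕ → Bool) → ℕ → Set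
Least b k = b k ≡ true × (∀ m → m < k → b m ≡ false)

-- `muC` stops at output 0 and demands successors before it, so it runs on the negated test, which
-- answers 0 on success and 1 on failure.
muP : {b : Carrier Γ → ℕ → Bool} {k : Carrier Γ → ℕ} →
      (∀ x → Least (b x) (k x)) →
      Test (Γ ▹ℕ) (λ (x , n) → not (b x n)) → Program Γ nat k
muP least P .code = muC (code P)
muP {Γ = Γ} {b} {k} least P .runs x =
  subst (λ c → ⟦ code P ⟧ (encode Γ x , k x) (bit (not c)))
        (proj₁ (least x)) (runs P (x , k x)) ,
  λ m m<k → 0 , subst (λ c → ⟦ code P ⟧ (encode Γ x , m) (bit (not c)))
                      (proj₂ (least x) m m<k) (runs P (x , m))

-- Boolean, arithmetic and list programs

ifP : {b : Carrier Γ → Bool} {u v : Carrier Γ → Val τ} →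
      Test Γ b → Program Γ τ u → Program Γ τ v →
      Program Γ τ (λ x → if b x then u x else v x)
ifP {Γ = Γ} {τ = τ} {b = b} {u = u} {v = v} B P R =
  convert agrees (natRecP {f = branch} B R (natPar P))
  where
  branch : Carrier Γ → ℕ → Val τ
  branch x zero    = v x
  branch x (suc _) = u x
  agrees : ∀ x → branch x (bit (b x)) ≡ (if b x then u x else v x)
  agrees x with b x
  ... | false = refl
  ... | true  = refl

trueP : Test Γ (λ _ → true)
trueP = litP 1

falseP : Test Γ (λ _ → false)
falseP = litP 0

notP : {b : Carrier Γ → Bool} →
       Test Γ b → Test Γ (λ x → not (b x))
notP {b = b} B = convert agrees (ifP B (litP 0) (litP 1))
  where
  agrees : ∀ x → (if b x then 0 else 1) ≡ bit (not (b x))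
  agrees x with b x
  ... | false = refl
  ... | true  = refl

andP : {b c : Carrier Γ → Bool} →
       Test Γ b → Test Γ c → Test Γ (λ x → b x ∧ c x)
andP {b = b} {c = c} B C = convert agrees (ifP B C falseP)
  where
  agrees : ∀ x → (if b x then bit (c x) else 0) ≡ bit (b x ∧ c x)
  agrees x with b x
  ... | false = refl
  ... | true  = refl

orP : {b c : Carrier Γ → Bool} →
      Test Γ b → Test Γ c → Test Γ (λ x → b x ∨ c x)
orP {b = b} {c = c} B C = convert agrees (ifP B trueP C)
  where
  agrees : ∀ x → (if b x then 1 else bit (c x)) ≡ bit (b x ∨ c x)
  agrees x with b x
  ... | false = refl
  ... | true  = refl

positive : ℕ → Bool
positive zero    = false
positive (suc _) = true

positiveP : {g : Carrier Γ → ℕ} →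
            Program Γ nat g → Test Γ (λ x → positive (g x))
positiveP G = natRecP {f = λ _ n → bit (positive n)} G falseP trueP

predP : {g : Carrier Γ → ℕ} →
        Program Γ nat g → Program Γ nat (λ x → pred (g x))
predP G = natRecP {f = λ _ n → pred n} G (litP 0) natIdx

addP : {g h : Carrier Γ → ℕ} →
       Program Γ nat g → Program Γ nat h → Program Γ nat (λ x → g x + h x)
addP {h = h} G H = natRecP {f = λ x n → n + h x} G H (sucP natVal)

monusP : {g h : Carrier Γ → ℕ} →
         Program Γ nat g → Program Γ nat h → Program Γ nat (λ x → g x ∸ h x)
monusP {g = g} G H =
  natRecP {f = λ x n → g x ∸ n} H G
    (convert (λ (x , n) → pred[m∸n]≡m∸[1+n] (g x) n) (predP natVal))

lessP : {g h : Carrier Γ → ℕ} →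
        Program Γ nat g → Program Γ nat h → Test Γ (λ x → g x <ᵇ h x)
lessP {g = g} {h = h} G H =
  convert (λ x → cong bit (agrees (g x) (h x))) (positiveP (monusP H G))
  where
  agrees : ∀ m n → positive (n ∸ m) ≡ (m <ᵇ n)
  agrees zero    zero    = refl
  agrees zero    (suc n) = refl
  agrees (suc m) zero    = refl
  agrees (suc m) (suc n) = agrees m n

equalP : {g h : Carrier Γ → ℕ} →
         Program Γ nat g → Program Γ nat h → Test Γ (λ x → g x ≡ᵇ h x)
equalP {g = g} {h = h} G H =
  convert (λ x → cong bit (agrees (g x) (h x)))
          (notP (orP (lessP G H) (lessP H G)))
  where
  agrees : ∀ m n → not ((m <ᵇ n) ∨ (n <ᵇ m)) ≡ (m ≡ᵇ n)
  agrees zero    zero    = refl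
  agrees zero    (suc n) = refl
  agrees (suc m) zero    = refl
  agrees (suc m) (suc n) = agrees m n

powerP : {g : Carrier Γ → ℕ} →
            Program Γ nat g → Program Γ nat (λ x → 2 ^ g x)
powerP G = natRecP {f = λ _ n → 2 ^ n} G (litP 1)
  (addP natVal (addP natVal (litP 0)))

allBelow : (ℕ → Bool) → ℕ → Bool
allBelow b zero    = true
allBelow b (suc n) = b n ∧ allBelow b n

allBelowP : {b : Carrier Γ → ℕ → Bool} {g : Carrier Γ → ℕ} →
            Test (Γ ▹ℕ) (λ (x , n) → b x n) →
            Program Γ nat g → Test Γ (λ x → allBelow (b x) (g x))
allBelowP {Γ = Γ} {b = b} B G =
  natRecP {f = λ x n → bit (allBelow (b x) n)} G trueP
    (andP {b = λ (x , n) → b x n} (run B id (pairP (fstP input) natIdx)) natVal)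

lengthP : {w : Carrier Γ → List (Val σ)} → Program Γ (list σ) w →
          Program Γ nat (λ x → length (w x))
lengthP W = listRecP {f = λ _ w → length w} W (litP 0) (sucP listVal)

appendP : {w v : Carrier Γ → List (Val σ)} → Program Γ (list σ) w →
          Program Γ (list σ) v → Program Γ (list σ) (λ x → w x ++ v x)
appendP {v = v} W V =
  listRecP {f = λ x w → w ++ v x} W V (consP listHead listVal)

marksP : {g : Carrier Γ → ℕ} {w : Carrier Γ → List ℕ} →
         Program Γ (list nat) w → Program Γ nat g →
         Test Γ (λ x → marks (w x) (g x))
marksP {g = g} W G =
  listRecP {f = λ x w → bit (marks w (g x))} W falseP
    (orP (equalP (listPar G) listHead) listVal)

-- Eventually periodic sequences

toFin : Bool → Fin 2
toFin false = zero
toFin true  = suc zero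

toFin-injective : ∀ {b c} → toFin b ≡ toFin c → b ≡ c
toFin-injective {false} {false} _ = refl
toFin-injective {true}  {true}  _ = refl

recurrence : ∀ {m} (x : ℕ → Fin m → Bool) →
             (∀ i j → x i ≗ x j → x (suc i) ≗ x (suc j)) →
             ∃[ t ] ∃[ π ] (0 < π × t + π ≤ 2 ^ m × (∀ k → t ≤ k → x (k + π) ≗ x k))
recurrence {m} x next
  -- The stages 0 to `2 ^ m` are one more than the states; the later of two equal stages is
  -- transient plus period, hence at most `2 ^ m`.
  with pigeonhole (n<1+n (2 ^ m)) (λ k → funToFin (toFin ∘ x (toℕ k)))
... | i , j , i<j , eq =
  t , π , m<n⇒0<n∸m i<j ,
  subst (_≤ 2 ^ m) (sym t+π≡j) (≤-pred (toℕ<n j)) , λ k t≤k →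
  subst (λ l → x (l + π) ≗ x l) (m∸n+n≡m t≤k) (from (k ∸ t))
  where
  t = toℕ i
  π = toℕ j ∸ t
  t+π≡j : t + π ≡ toℕ j
  t+π≡j = m+[n∸m]≡n (<⇒≤ i<j)
  decode : ∀ k q → finToFun (funToFin (toFin ∘ x k)) q ≡ toFin (x k q)
  decode k = finToFun-funToFin (toFin ∘ x k)
  repeats : x (t + π) ≗ x t
  repeats q = toFin-injective (trans (cong (λ l → toFin (x l q)) t+π≡j)
    (trans (sym (decode (toℕ j) q))
    (trans (cong (λ z → finToFun z q) (sym eq)) (decode t q))))
  from : ∀ d → x (d + t + π) ≗ x (d + t)
  from zero    = repeats
  from (suc d) = next _ _ (from d)

least : (b : ℕ → Bool) → ∀ n → b n ≡ true → ∃[ k ] (Least b k × k ≤ n)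
least b n bn with b 0 in b0
... | true = 0 , (b0 , λ _ ()) , z≤n
least b zero    bn | false with () ← trans (sym b0) bn
least b (suc n) bn | false =
  let k , (bk , below) , k≤n = least (b ∘ suc) n bn in
  suc k , (bk , λ { zero _ → b0 ; (suc m) (s≤s m<k) → below m m<k }) , s≤s k≤n

least-≤ : ∀ {b k n} → Least b k → b n ≡ true → k ≤ n
least-≤ {k = k} {n} (_ , below) bn with k ≤? n
... | yes k≤n = k≤n
... | no  k≰n with () ← trans (sym bn) (below n (≰⇒> k≰n))

∧-intro : ∀ {b c} → b ≡ true → c ≡ true → b ∧ c ≡ true
∧-intro refl refl = refl

∧-elim : ∀ b {c} → b ∧ c ≡ true → b ≡ true × c ≡ true
∧-elim true e = refl , e

allBelow-sound : ∀ {b} n → allBelow b n ≡ true → ∀ k → k < n → b k ≡ true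
allBelow-sound (suc n) e k k<1+n with ∧-elim _ e | k ≟ n
... | bn , _    | yes refl = bn
... | _  , rest | no  k≢n  = allBelow-sound n rest k (≤∧≢⇒< (≤-pred k<1+n) k≢n)

allBelow-complete : ∀ {b} n → (∀ k → k < n → b k ≡ true) → allBelow b n ≡ true
allBelow-complete zero    h = refl
allBelow-complete (suc n) h =
  ∧-intro (h n ≤-refl) (allBelow-complete n (λ k → h k ∘ m<n⇒m<1+n))

-- The biconditional, spelled with the connectives that already have programs.
same : Bool → Bool → Bool
same b c = (b ∧ c) ∨ not (b ∨ c)

≡⇒same : ∀ {b c} → b ≡ c → same b c ≡ true
≡⇒same {false} refl = refl
≡⇒same {true}  refl = refl

same⇒≡ : ∀ b c → same b c ≡ true → b ≡ c
same⇒≡ true  true  _ = refl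
same⇒≡ false false _ = refl

module _ {s : ℕ → Bool} where

  periodic-* : ∀ {t π} → PeriodicFrom s t π → ∀ j k → t ≤ k → s (k + j * π) ≡ s k
  periodic-* {π = π} _ zero k t≤k = cong s (+-identityʳ k)
  periodic-* {π = π} per@(_ , h) (suc j) k t≤k =
    trans (cong s (sym (+-assoc k π (j * π))))
          (trans (periodic-* per j (k + π) (≤-trans t≤k (m≤m+n k π))) (h k t≤k))

  -- Adding `t′ * π` moves any index past `t′`, since `0 < π`; there `π′` applies, and removing the
  -- same multiple of `π` returns.
  periodic-earlier : ∀ {t π t′ π′} → PeriodicFrom s t π → PeriodicFrom s t′ π′ →
                     PeriodicFrom s t π′
  periodic-earlier {t} {π} {t′} {π′} per@(0<π , _) (0<π′ , h′) = 0<π′ , λ k t≤k →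
    let c = t′ * π
        t′≤c = m≤m*n t′ π {{>-nonZero 0<π}} in
    trans (sym (periodic-* per t′ (k + π′) (≤-trans t≤k (m≤m+n k π′))))
    (trans (cong s (xy∙z≈xz∙y k π′ c))
    (trans (h′ (k + c) (≤-trans t′≤c (m≤n+m c k)))
           (periodic-* per t′ k t≤k)))

-- Once the transient and the period are at most N, comparing the window
-- [N, 2N) with its translate by π decides whether π is an eventual period.

isPeriod : (ℕ → Bool) → ℕ → ℕ → Bool
isPeriod s N π =
  positive π ∧ allBelow (λ k → same (s (N + k + π)) (s (N + k))) N

module _ {s : ℕ → Bool} where

  isPeriod-complete : ∀ {t N π} → t ≤ N → PeriodicFrom s t π → isPeriod s N π ≡ true
  isPeriod-complete {N = N} {suc π} t≤N (_ , h) = allBelow-complete N λ k _ →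
    ≡⇒same (h (N + k) (≤-trans t≤N (m≤m+n N k)))

  -- A position beyond the window is moved back by `π` until it lies inside. It and its translate by
  -- `π′` stay beyond `t`, so neither value changes.
  isPeriod-sound : ∀ {t π N π′} → PeriodicFrom s t π → t + π ≤ N →
                   isPeriod s N π′ ≡ true → PeriodicFrom s N π′
  isPeriod-sound {t} {π} {N} {suc π′} (0<π , h) t+π≤N e =
    z<s , λ k N≤k → subst (λ l → s (l + suc π′) ≡ s l) (m+[n∸m]≡n N≤k) 
      (go _ (<-wellFounded _))
    where
    t≤N = m+n≤o⇒m≤o t t+π≤N
    go : ∀ j → Acc _<_ j → s (N + j + suc π′) ≡ s (N + j)
    go j (acc rec) with j <? N
    ... | yes j<N = same⇒≡ (s (N + j + suc π′)) (s (N + j))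
      (allBelow-sound {b = λ k → same (s (N + k + suc π′)) (s (N + k))} N e j j<N)
    ... | no  j≮N = begin
      s (N + j + suc π′)      ≡⟨ cong (λ l → s (l + suc π′)) split ⟩
      s (N + i + π + suc π′)  ≡⟨ cong s (xy∙z≈xz∙y (N + i) π (suc π′)) ⟩
      s (N + i + suc π′ + π)  ≡⟨ h _ (m≤n⇒m≤n+o (suc π′) t≤N+i) ⟩
      s (N + i + suc π′)      ≡⟨ go i (rec (∸-monoʳ-< {j} {π} {0} 0<π π≤j)) ⟩
      s (N + i)               ≡⟨ h _ t≤N+i ⟨
      s (N + i + π)           ≡⟨ cong s split ⟨
      s (N + j)               ∎
      where
      open ≡-Reasoning
      π≤j = ≤-trans (m+n≤o⇒n≤o t t+π≤N) (≮⇒≥ j≮N)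
      i = j ∸ π
      t≤N+i = m≤n⇒m≤n+o i t≤N
      split : N + j ≡ N + i + π
      split = trans (cong (N +_) (sym (m∸n+n≡m π≤j))) (sym (+-assoc N i π))

  -- Minimality covers eventual periods with any starting point: by `periodic-earlier` each of them
  -- holds from `t` on and so passes the test.
  least-isPeriod : ∀ {t π N π′} → PeriodicFrom s t π → t + π ≤ N →
                   Least (isPeriod s N) π′ → EventualPeriod s π′
  least-isPeriod {t} per t+π≤N l@(e , _) =
    (_ , isPeriod-sound per t+π≤N e) , λ t′ π′ per′ →
    least-≤ l (isPeriod-complete (m+n≤o⇒m≤o t t+π≤N) (periodic-earlier per per′))

  -- The start moves down as long as the one additional equation holds; where it fails, every start
  -- at or before that point is refuted.
  least-transient : ∀ t {π} → PeriodicFrom s t π → ∃[ t′ ] (Transient s π t′ × t′ ≤ t)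
  least-transient zero    per = 0 , (per , λ _ _ → z≤n) , z≤n
  least-transient (suc t) {π} per@(0<π , h) with s (t + π) ≟ᵇ s t
  ... | yes e =
    let t′ , tr , t′≤t = least-transient t (0<π , λ k t≤k → earlier k t≤k (t ≟ k))
    in
    t′ , tr , m≤n⇒m≤1+n t′≤t
    where
    earlier : ∀ k → t ≤ k → Dec (t ≡ k) → s (k + π) ≡ s k
    earlier k t≤k (yes refl) = e
    earlier k t≤k (no t≢k)   = h k (≤∧≢⇒< t≤k t≢k)
  ... | no ¬e = suc t , (per , λ t′ per′ → ≰⇒> (λ t′≤t → ¬e (proj₂ per′ t t′≤t))) , ≤-refl

  -- Period and transient can be minimised one after the other: the smaller period still holds from
  -- the old `t` on, so neither summand grows.
  transient+period : ∀ {t π} → PeriodicFrom s t π →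
                     ∃[ t′ ] ∃[ π′ ] (EventualPeriod s π′ × Transient s π′ t′ ×
                                      t′ + π′ ≤ t + π)
  transient+period {t} {π} per
    with least (isPeriod s (t + π)) π (isPeriod-complete (m≤m+n t π) per)
  ... | π′ , l , π′≤π with least-isPeriod per ≤-refl l
  ... | ev@((_ , per′) , _) with least-transient t (periodic-earlier per per′)
  ... | t′ , tr , t′≤t = t′ , π′ , ev , tr , +-mono-≤ t′≤t π′≤π

sameP : {b c : Carrier Γ → Bool} →
        Test Γ b → Test Γ c → Test Γ (λ x → same (b x) (c x))
sameP B C = orP (andP B C) (notP (orP B C))

fromComputable : {A : Set} {σ τ : Sort} {enc : A → Val σ} {g : A → Val τ} →
                 Computable σ τ enc g → Program (rep A σ enc) τ g
fromComputable (c , h) = program c h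

-- Finite sets of indices as lists

∈⇒marks : ∀ {q X} → q ∈ X → marks X q ≡ true
∈⇒marks {q} {X} = dec-true (q ∈? X)

marks⇒∈ : ∀ {q} X → marks X q ≡ true → q ∈ X
marks⇒∈ {q} X e with q ∈? X
... | yes q∈X = q∈X

-- Within `X`, the list of marked members stands for the assignment `b`; `fill-comp` takes
-- assignments in this form.
marks-filter : ∀ b {q X} → q ∈ X → marks (filterᵇ b X) q ≡ b q
marks-filter b {q} {X} q∈X with b q in bq
... | true  = ∈⇒marks (∈-filter⁺ (T? ∘ b) q∈X (Equivalence.from T-≡ bq))
... | false = dec-false (q ∈? filterᵇ b X) λ q∈ →
  subst T bq (proj₂ (∈-filter⁻ (T? ∘ b) {xs = X} q∈))

filterP : {b : Carrier Γ → ℕ → Bool} {w : Carrier Γ → List ℕ} →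
          Test (Γ ▹ℕ) (λ (x , n) → b x n) → Program Γ (list nat) w →
          Program Γ (list nat) (λ x → filterᵇ (b x) (w x))
filterP {Γ = Γ} {b = b} B W =
  listRecP {f = λ x w → filterᵇ (b x) w} W nilP
    (convert agrees (ifP (run B (λ (x , n , _) → x , n) (pairP (fstP input) listHead))
                         (consP listHead listVal) listVal))
  where
  agrees : ∀ ((x , n , w) : Carrier Γ × ℕ × List ℕ) →
           (if b x n then n ∷ filterᵇ (b x) w else filterᵇ (b x) w) ≡
           filterᵇ (b x) (n ∷ w)
  agrees (x , n , w) with b x n
  ... | false = refl
  ... | true  = refl

_⊆ᵇ_ : List ℕ → List ℕ → Bool
[]       ⊆ᵇ X = true
(y ∷ ys) ⊆ᵇ X = marks X y ∧ (ys ⊆ᵇ X)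

⊆ᵇ-sound : ∀ Y {X} → Y ⊆ᵇ X ≡ true → ∀ {q} → q ∈ Y → q ∈ X
⊆ᵇ-sound (y ∷ Y) {X} e (here refl) = marks⇒∈ X (proj₁ (∧-elim _ e))
⊆ᵇ-sound (y ∷ Y) {X} e (there q∈Y) = ⊆ᵇ-sound Y (proj₂ (∧-elim (marks X y) e)) q∈Y

⊆ᵇ-complete : ∀ Y {X} → (∀ {q} → q ∈ Y → q ∈ X) → Y ⊆ᵇ X ≡ true
⊆ᵇ-complete []      h = refl
⊆ᵇ-complete (y ∷ Y) h = ∧-intro (∈⇒marks (h (here refl))) (⊆ᵇ-complete Y (h ∘ there))

⊆P : {Y X : Carrier Γ → List ℕ} → Program Γ (list nat) Y → Program Γ (list nat) X →
     Test Γ (λ x → Y x ⊆ᵇ X x)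
⊆P {X = X} PY PX = listRecP {f = λ x Y → bit (Y ⊆ᵇ X x)} PY trueP
  (andP (marksP (listPar PX) listHead) listVal)

-- The iterates over a decidable domain

module Network {D : Domain} (P : Presentation D) (dec : Decidable D) where
  open Domain D
  open Presentation P hiding (index)

  asked : ℕ → List ℕ
  asked = Q P

  a : ℕ → ℕ → Bool
  a = iterates P dec

  manifests : L → Bool
  manifests s = does (manifests? D dec s)

  iterates-cong : ∀ p f g → (∀ q → q ∈ asked p → f q ≡ g q) →
                  not (manifests (fill (ν p) f)) ≡ not (manifests (fill (ν p) g))
  iterates-cong p f g h = cong (not ∘ manifests) (fill-cong (ν p) f g h)

  Closed : List ℕ → Set
  Closed X = ∀ {q r} → q ∈ X → r ∈ asked q → r ∈ X

  -- The state at stage `k` is the tuple of values at the positions of `X`. Repetitions in `X` are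
  -- therefore harmless, as the lists produced by `reach` require.
  closed-periodic : ∀ {p X} → p ∈ X → Closed X →
    ∃[ t ] ∃[ π ] (PeriodicFrom (λ k → a k p) t π × t + π ≤ 2 ^ length X)
  closed-periodic {p} {X} p∈X closed =
    let t , π , 0<π , bound , h = recurrence (λ k i → a k (lookup X i)) lockstep in
    t , π , (0<π , λ k t≤k →
      subst (λ q → a (k + π) q ≡ a k q) (sym (lookup-index p∈X)) (h k t≤k (index p∈X))) ,
    bound
    where
    lockstep : ∀ i j → (λ l → a i (lookup X l)) ≗ (λ l → a j (lookup X l)) →
               (λ l → a (suc i) (lookup X l)) ≗ (λ l → a (suc j) (lookup X l))
    lockstep i j e l = iterates-cong (lookup X l) (a i) (a j) λ q q∈ →
      let q∈X = closed (∈-lookup {xs = X} l) q∈ in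
      subst (λ q → a i q ≡ a j q) (sym (lookup-index q∈X)) (e (index q∈X))

  bounded : ∀ p n → HasSize (Q* P p) n →
    ∃[ t ] ∃[ π ] (EventualPeriod (λ k → a k p) π ×
                   Transient (λ k → a k p) π t × t + π ≤ 2 ^ n)
  bounded p n (X , _ , refl , X⇔) =
    let _ , _ , per , bound = closed-periodic (from base)
                           (λ q∈X r∈ → from (step (to q∈X) r∈))
        t , π , ev , tr , le = transient+period per
    in t , π , ev , tr , ≤-trans le bound
    where
    to : ∀ {q} → q ∈ X → Q* P p q
    to {q} = Equivalence.to (X⇔ q)
    from : ∀ {q} → Q* P p q → q ∈ X
    from {q} = Equivalence.from (X⇔ q)

  -- Enumerating the closure

  reach : ℕ → ℕ → List ℕ
  reach p zero    = asked p
  reach p (suc j) = reach p j ++ concatMap asked (reach p j)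

  ∈-concatMap-asked : ∀ {X q r} → q ∈ X → r ∈ asked q → r ∈ concatMap asked X
  ∈-concatMap-asked q∈X r∈ = ∈-concatMap⁺ asked (Any.map (λ { refl → r∈ }) q∈X)

  ∈-concatMap-asked⁻ : ∀ {r} X → r ∈ concatMap asked X → ∃[ q ] (q ∈ X × r ∈ asked q)
  ∈-concatMap-asked⁻ X r∈ =
    let q , q∈X , r∈q = find (∈-concatMap⁻ asked {xs = X} r∈) in q , q∈X , r∈q

  reach-mono : ∀ {p q} d j → q ∈ reach p j → q ∈ reach p (d + j)
  reach-mono zero    j q∈ = q∈
  reach-mono (suc d) j q∈ = ∈-++⁺ˡ (reach-mono d j q∈)

  reach⇒Q* : ∀ {p q} j → q ∈ reach p j → Q* P p q
  reach⇒Q* zero q∈ = step base q∈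
  reach⇒Q* {p} (suc j) q∈ with ∈-++⁻ (reach p j) q∈
  ... | inj₁ q∈j = reach⇒Q* j q∈j
  ... | inj₂ q∈c =
    let _ , r∈ , q∈r = ∈-concatMap-asked⁻ (reach p j) q∈c in step (reach⇒Q* j r∈) q∈r

  Q*⇒reach : ∀ {p q} → Q* P p q → q ≡ p ⊎ ∃[ j ] q ∈ reach p j
  Q*⇒reach base = inj₁ refl
  Q*⇒reach {p} (step r∈ q∈) with Q*⇒reach r∈
  ... | inj₁ refl     = inj₂ (0 , q∈)
  ... | inj₂ (j , r∈j) = inj₂ (suc j , ∈-++⁺ʳ (reach p j) (∈-concatMap-asked r∈j q∈))

  stable : ℕ → ℕ → Bool
  stable p j = concatMap asked (reach p j) ⊆ᵇ reach p j

  -- A common stage exists because `reach` only grows. The index `p` is exempted: it belongs to the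
  -- closure even when no gate asks for it.
  reach-all : ∀ {p} ys → (∀ {q} → q ∈ ys → Q* P p q) →
              ∃[ j ] (∀ {q} → q ∈ ys → q ≡ p ⊎ q ∈ reach p j)
  reach-all [] h = 0 , λ ()
  reach-all {p} (y ∷ ys) h with reach-all ys (h ∘ there) | Q*⇒reach (h (here refl))
  ... | j , rest | inj₁ y≡p       = j , λ { (here refl) → inj₁ y≡p ; (there q∈) → rest q∈ }
  ... | j , rest | inj₂ (i , y∈i) = i + j , λ
    { (here refl) → inj₂ (subst (λ k → y ∈ reach p k) (+-comm j i) (reach-mono j i y∈i))
    ; (there q∈) → map₂ (reach-mono i j) (rest q∈) }

  -- At the stage `j` from `reach-all` at most `p` is missing. If the list is not closed there, `p`
  -- enters next and nothing can be added afterwards.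
  stabilises : ∀ {p n} → HasSize (Q* P p) n → ∃[ j ] stable p j ≡ true
  stabilises {p} (X , _ , _ , X⇔) with reach-all X (λ {q} → Equivalence.to (X⇔ q))
  ... | j , all with stable p j in e
  ...   | true  = j , e
  ...   | false = suc j , ⊆ᵇ-complete (concatMap asked (reach p (suc j)))
                            (in-next ∘ ∈-++⁺ʳ (reach p (suc j)))
    where
    cover : ∀ {q} i → q ∈ reach p i → q ≡ p ⊎ q ∈ reach p j
    cover {q} i q∈ = all (Equivalence.from (X⇔ q) (reach⇒Q* i q∈))
    old : ¬ p ∈ reach p (suc j) → ∀ {q} → q ∈ reach p (suc j) → q ∈ reach p j
    old p∉ q∈ with cover (suc j) q∈
    ... | inj₁ refl = ⊥-elim (p∉ q∈)
    ... | inj₂ q∈j  = q∈j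
    -- The set grows at this step, and the only point it can gain is p.
    p∈next : p ∈ reach p (suc j)
    p∈next with p ∈? reach p (suc j)
    ... | yes p∈ = p∈
    ... | no  p∉ with () ← trans (sym e)
            (⊆ᵇ-complete (concatMap asked (reach p j)) λ q∈ → old p∉ (∈-++⁺ʳ (reach p j) q∈))
    in-next : ∀ {q} → q ∈ reach p (suc (suc j)) → q ∈ reach p (suc j)
    in-next q∈ with cover (suc (suc j)) q∈
    ... | inj₁ refl = p∈next
    ... | inj₂ q∈j  = ∈-++⁺ˡ q∈j

  -- The iterates computed on a closed list

  value : L⁺ → List ℕ → Bool
  value s M = not (manifests (fill s (marks M)))

  -- The iterates as finite data: the members of `X` that are mark at stage `k`, with gates outside
  -- `X` read as void. For closed `X` no such gate occurs in the systems indexed by `X`.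
  marked : List ℕ → ℕ → List ℕ
  marked X zero    = []
  marked X (suc k) = filterᵇ (λ q → value (ν q) (marked X k)) X

  marks-marked : ∀ {X} → Closed X → ∀ k {q} → q ∈ X → marks (marked X k) q ≡ a k q
  value-marked : ∀ {X} → Closed X → ∀ k p → (∀ {q} → q ∈ asked p → q ∈ X) →
                 value (ν p) (marked X k) ≡ a (suc k) p

  marks-marked closed zero    q∈X = refl
  marks-marked {X} closed (suc k) {q} q∈X =
    trans (marks-filter (λ q → value (ν q) (marked X k)) q∈X)
          (value-marked closed k q (closed q∈X))

  value-marked {X} closed k p p⊆X =
    iterates-cong p _ _ λ q q∈ → marks-marked closed k (p⊆X q∈)

  -- The promise of finiteness is in the carrier but not in the encoding: halting is claimed only
  -- under it, and the program does not see it.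
  Finite : Rep
  Finite = rep (Σ[ p ∈ ℕ ] ∃[ n ] HasSize (Q* P p) n) tree (λ (p , _) → ⌜ ν p ⌝)

  -- The least stable stage is what the search in `hullP` finds; the stage from `stabilises` only
  -- shows that there is one.
  depth : Carrier Finite → ℕ
  depth (p , _ , size) = let j , e = stabilises size in proj₁ (least (stable p) j e)

  depth-least : ∀ x → Least (stable (proj₁ x)) (depth x)
  depth-least (p , _ , size) =
    let j , e = stabilises size in proj₁ (proj₂ (least (stable p) j e))

  hull : Carrier Finite → List ℕ
  hull x = reach (proj₁ x) (depth x)

  asked⊆reach : ∀ {p q} j → q ∈ asked p → q ∈ reach p j
  asked⊆reach zero    q∈ = q∈
  asked⊆reach (suc j) q∈ = ∈-++⁺ˡ (asked⊆reach j q∈)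

  hull-closed : ∀ x → Closed (hull x)
  hull-closed x q∈ r∈ =
    ⊆ᵇ-sound (concatMap asked (hull x)) (proj₁ (depth-least x)) (∈-concatMap-asked q∈ r∈)

  -- Exceeds the transient plus the period of the iterates on the closed
  -- set p ∷ hull x; the successor makes every index tested a successor.

  horizon : Carrier Finite → ℕ
  horizon x = suc (2 ^ suc (length (hull x)))

  iterate-at : Carrier Finite → ℕ → Bool
  iterate-at x k = a k (proj₁ x)

  periodic : ∀ x → ∃[ t ] ∃[ π ] (PeriodicFrom (iterate-at x) t π × t + π ≤ horizon x)
  periodic x@(p , _) =
    let t , π , per , bound = closed-periodic {X = p ∷ hull x} (here refl) closed
    in t , π , per , m≤n⇒m≤1+n bound
    where
    closed : Closed (p ∷ hull x)
    closed (here refl) r∈ = there (asked⊆reach (depth x) r∈)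
    closed (there q∈)  r∈ = there (hull-closed x q∈ r∈)

  least-period : ∀ x → ∃[ π ] Least (isPeriod (iterate-at x) (horizon x)) π
  least-period x =
    let t , π , per , bound = periodic x
        π′ , l , _ = least (isPeriod (iterate-at x) (horizon x)) π
                           (isPeriod-complete (m+n≤o⇒m≤o t bound) per)
    in π′ , l

  eventual-period : ∀ x → EventualPeriod (iterate-at x) (proj₁ (least-period x))
  eventual-period x =
    let _ , _ , per , bound = periodic x in
    least-isPeriod per bound (proj₂ (least-period x))

  -- Programs for the closure, the iterates and the period

  gatesP : {s : Carrier Γ → L⁺} → Program Γ tree (λ x → ⌜ s x ⌝) →
           Program Γ (list nat) (λ x → gates (s x))
  gatesP {s = s} = run (fromComputable gates-comp) s

  νP : {g : Carrier Γ → ℕ} → Program Γ nat g → Program Γ tree (λ x → ⌜ ν (g x) ⌝)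
  νP {g = g} = run (fromComputable ν-comp) g

  manifestsP : Test (rep L tree (λ s → ⌜ embed s ⌝)) manifests
  manifestsP = program (proj₁ dec) correct
    where
    correct : ∀ s → ⟦ proj₁ dec ⟧ ⌜ embed s ⌝ (bit (manifests s))
    correct s with proj₂ dec s
    ... | inj₁ (_ , h) = h
    ... | inj₂ (_ , h) = h

  valueP : {s : Carrier Γ → L⁺} {M : Carrier Γ → List ℕ} →
           Program Γ tree (λ x → ⌜ s x ⌝) → Program Γ (list nat) M →
           Test Γ (λ x → value (s x) (M x))
  valueP {s = s} {M} S W =
    notP (run manifestsP (λ x → fill (s x) (marks (M x)))
              (run (fromComputable fill-comp) (λ x → s x , M x) (pairP S W)))

  concatMap-askedP : {X : Carrier Γ → List ℕ} → Program Γ (list nat) X →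
                     Program Γ (list nat) (λ x → concatMap asked (X x))
  concatMap-askedP X = listRecP {f = λ _ w → concatMap asked w} X nilP
    (appendP (gatesP (νP listHead)) listVal)

  markedP : {X : Carrier Γ → List ℕ} {k : Carrier Γ → ℕ} → Program Γ (list nat) X →
            Program Γ nat k → Program Γ (list nat) (λ x → marked (X x) (k x))
  markedP {X = X} PX K = natRecP {f = λ x k → marked (X x) k} K nilP
    (filterP (valueP (νP idx) (par natVal)) (natPar PX))

  reachP : {k p : Carrier Γ → ℕ} →
           Program Γ tree (λ x → ⌜ ν (p x) ⌝) → Program Γ nat k →
           Program Γ (list nat) (λ x → reach (p x) (k x))
  reachP {p = p} T K = natRecP {f = λ x j → reach (p x) j} K (gatesP T)
    (appendP natVal (concatMap-askedP natVal))

  hullP : Program Finite (list nat) hull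
  hullP = reachP {p = proj₁} input (muP depth-least
    (notP (⊆P (concatMap-askedP (reachP (par input) idx)) (reachP (par input) idx))))

  -- One evaluation of `ν p` with the values of stage `k` on the hull, which contains all gates of
  -- `ν p`; the number `p` does not enter.
  iterateP : Test (Finite ▹ℕ) (λ (x , k) → iterate-at x (suc k))
  iterateP = convert
    (λ (x , k) → cong bit
      (value-marked (hull-closed x) k (proj₁ x) (asked⊆reach (depth x))))
    (valueP (par input) (markedP (par hullP) idx))

  iterate-atP : (x : Carrier Γ → Carrier Finite) {k : Carrier Γ → ℕ} →
                Program Γ tree (λ y → ⌜ ν (proj₁ (x y)) ⌝) → Program Γ nat k →
                Test Γ (λ y → iterate-at (x y) (suc (k y)))
  iterate-atP x {k} X K = run iterateP (λ y → x y , k y) (pairP X K)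

  periodP : Program Finite nat (λ x → proj₁ (least-period x))
  periodP = muP (λ x → proj₂ (least-period x)) (notP (andP (positiveP idx)
      (allBelowP (sameP (iterate-atP (proj₁ ∘ proj₁) (par (par input))
                                     (addP (addP (par (par N)) idx) (par idx)))
                        (iterate-atP (proj₁ ∘ proj₁) (par (par input))
                                     (addP (par (par N)) idx)))
                 (par (sucP N)))))
    where
    N : Program Finite nat (λ x → 2 ^ suc (length (hull x)))
    N = powerP (sucP (lengthP hullP))

  period-computable : Σ[ c ∈ Code tree nat ] (∀ p n → HasSize (Q* P p) n →
    ∃[ π ] (EventualPeriod (λ k → a k p) π × ⟦ c ⟧ ⌜ ν p ⌝ π))
  period-computable = code periodP , λ p n size →
    _ , eventual-period (p , n , size) , runs periodP (p , n , size)

-- The re-entry language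

topLabel : Tree → ℕ
topLabel leaf         = 0
topLabel (node n _ _) = n

leftTree rightTree : Tree → Tree
leftTree leaf          = leaf
leftTree (node _ l _)  = l
rightTree leaf         = leaf
rightTree (node _ _ r) = r

isLeaf : Tree → Bool
isLeaf leaf         = true
isLeaf (node _ _ _) = false

isNumeral : Tree → Bool
isNumeral leaf         = false
isNumeral (node _ l r) = isLeaf l ∧ isLeaf r

module _ {t : Carrier Γ → Tree} (R : Program Γ tree t) where

  topLabelP : Program Γ nat (λ x → topLabel (t x))
  topLabelP = treeRecP {f = λ _ → topLabel} R (litP 0) treeLabel

  leftTreeP : Program Γ tree (λ x → leftTree (t x))
  leftTreeP = treeRecP {f = λ _ → leftTree} R leafP treeLeft

  rightTreeP : Program Γ tree (λ x → rightTree (t x))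
  rightTreeP = treeRecP {f = λ _ → rightTree} R leafP treeRight

  isLeafP : Test Γ (λ x → isLeaf (t x))
  isLeafP = treeRecP {f = λ _ → bit ∘ isLeaf} R trueP falseP

module _ {t : Carrier Γ → Tree} (R : Program Γ tree t) where

  isNumeralP : Test Γ (λ x → isNumeral (t x))
  isNumeralP = treeRecP {f = λ _ → bit ∘ isNumeral} R falseP
    (andP (isLeafP treeLeft) (isLeafP treeRight))

ifᵇP : {b c d : Carrier Γ → Bool} → Test Γ b → Test Γ c → Test Γ d →
       Test Γ (λ x → if b x then c x else d x)
ifᵇP {b = b} {c} {d} B C D = convert agrees (ifP B C D)
  where
  agrees : ∀ x → (if b x then bit (c x) else bit (d x)) ≡
                 bit (if b x then c x else d x)
  agrees x with b x
  ... | false = refl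
  ... | true  = refl

-- Labels are compared by `≡ᵇ` instead of matched, so that the program `validEP` repeats the
-- definition clause by clause.
validE : ℕ → Tree → Bool
validE m leaf         = true
validE m (node n l r) =
  if n ≡ᵇ 0 then validE m l ∧ isLeaf r else
  if n ≡ᵇ 1 then validE m l ∧ validE m r else
  if n ≡ᵇ 2 then (isNumeral l ∧ isLeaf r) ∧ (topLabel l <ᵇ m) else
  if n ≡ᵇ 3 then isNumeral l ∧ isLeaf r else false

validV : ℕ → Tree → Bool
validV m leaf         = true
validV m (node n l r) = ((n ≡ᵇ 4) ∨ (n ≡ᵇ 5)) ∧ (validE m l ∧ validV m r)

-- The code does not store the number of state variables; it is recovered as the length of the right
-- spine, and `validR` bounds the observed coordinate and all variables by it.
width : Tree → ℕ
width leaf         = 0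
width (node _ _ r) = suc (width r)

validR : Tree → Bool
validR leaf         = false
validR (node n l r) =
  (n ≡ᵇ 6) ∧ ((isNumeral l ∧ (topLabel l <ᵇ width r)) ∧ validV (width r) r)

module _ {m : Carrier Γ → ℕ} {t : Carrier Γ → Tree}
         (M : Program Γ nat m) (R : Program Γ tree t) where

  validEP : Test Γ (λ x → validE (m x) (t x))
  validEP = treeRecP {f = λ x t → bit (validE (m x) t)} R trueP
    (ifᵇP (equalP treeLabel (litP 0)) (andP leftVal (isLeafP treeRight))
    (ifᵇP (equalP treeLabel (litP 1)) (andP leftVal rightVal)
    (ifᵇP (equalP treeLabel (litP 2))
          (andP (andP (isNumeralP treeLeft) (isLeafP treeRight))
                (lessP (topLabelP treeLeft) (treePar M)))
    (ifᵇP (equalP treeLabel (litP 3))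
          (andP (isNumeralP treeLeft) (isLeafP treeRight)) falseP))))

module _ {m : Carrier Γ → ℕ} {t : Carrier Γ → Tree}
         (M : Program Γ nat m) (R : Program Γ tree t) where

  validVP : Test Γ (λ x → validV (m x) (t x))
  validVP = treeRecP {f = λ x t → bit (validV (m x) t)} R trueP
    (andP (orP (equalP treeLabel (litP 4)) (equalP treeLabel (litP 5)))
          (andP (validEP (treePar M) treeLeft) rightVal))

module _ {t : Carrier Γ → Tree} (R : Program Γ tree t) where

  widthP : Program Γ nat (λ x → width (t x))
  widthP = treeRecP {f = λ _ → width} R (litP 0) (sucP rightVal)

module _ {t : Carrier Γ → Tree} (R : Program Γ tree t) where

  validRP : Test Γ (λ x → validR (t x))
  validRP = treeRecP {f = λ _ → bit ∘ validR} R falseP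
    (andP (equalP treeLabel (litP 6))
    (andP (andP (isNumeralP treeLeft) (lessP (topLabelP treeLeft) (widthP treeRight)))
          (validVP (widthP treeRight) treeRight)))

∧-split : ∀ {b c} → T (b ∧ c) → T b × T c
∧-split = Equivalence.to T-∧

∧-join : ∀ {b c} → T b → T c → T (b ∧ c)
∧-join x y = Equivalence.from T-∧ (x , y)

leaf-sound : ∀ t → T (isLeaf t) → leaf ≡ t
leaf-sound leaf _ = refl

numeral-sound : ∀ t → T (isNumeral t) → numeral (topLabel t) ≡ t
numeral-sound (node n leaf leaf) _ = refl

validE-sound : ∀ m t → T (validE m t) → Σ[ e ∈ Expr ℕ m ] codeE e ≡ t
validE-sound m leaf _ = void , refl
validE-sound m (node 0 l r) v with ∧-split v
... | vl , vr with validE-sound m l vl | leaf-sound r vr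
... | e , refl | refl = cross e , refl
validE-sound m (node 1 l r) v with ∧-split {validE m l} v
... | vl , vr with validE-sound m l vl | validE-sound m r vr
... | e , refl | f , refl = juxt e f , refl
validE-sound m (node 2 l r) v with ∧-split {isNumeral l ∧ isLeaf r} v
... | lr , bound with ∧-split lr
... | vl , vr with leaf-sound r vr
... | refl = var (fromℕ< (<ᵇ⇒< (topLabel l) m bound)) ,
  cong (λ t → node 2 t leaf) (trans (cong numeral (toℕ-fromℕ< _)) (numeral-sound l vl))
validE-sound m (node 3 l r) v with ∧-split v
... | vl , vr with leaf-sound r vr
... | refl = ask (topLabel l) , cong (λ t → node 3 t leaf) (numeral-sound l vl)

validV-sound : ∀ m t → T (validV m t) →
               Σ[ i ∈ Vec Bool (width t) ] Σ[ u ∈ Vec (Expr ℕ m) (width t) ] codeV i u ≡ t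
validV-sound m leaf _ = [] , [] , refl
validV-sound m (node 4 l r) v with ∧-split v
... | vl , vr with validE-sound m l vl | validV-sound m r vr
... | e , el | i , u , er = false ∷ i , e ∷ u , cong₂ (node 4) el er
validV-sound m (node 5 l r) v with ∧-split v
... | vl , vr with validE-sound m l vl | validV-sound m r vr
... | e , el | i , u , er = true ∷ i , e ∷ u , cong₂ (node 5) el er

validR-sound : ∀ t → T (validR t) → Σ[ s ∈ System ℕ ] codeR s ≡ t
validR-sound (node 6 l r) v with ∧-split {isNumeral l ∧ (topLabel l <ᵇ width r)} v
... | lo , vr with ∧-split {isNumeral l} lo | validV-sound (width r) r vr
... | vl , bound | i , u , er =
  system (fromℕ< (<ᵇ⇒< (topLabel l) (width r) bound)) i u ,
  cong₂ (node 6) (trans (cong numeral (toℕ-fromℕ< _)) (numeral-sound l vl)) er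

validE-complete : ∀ {m} (e : Expr ℕ m) → T (validE m (codeE e))
validE-complete void       = tt
validE-complete (var i)    = <⇒<ᵇ (toℕ<n i)
validE-complete (cross e)  = ∧-join (validE-complete e) tt
validE-complete (juxt e f) = ∧-join (validE-complete e) (validE-complete f)
validE-complete (ask q)    = tt

validV-complete : ∀ {m k} (i : Vec Bool k) (u : Vec (Expr ℕ m) k) → T (validV m (codeV i u))
validV-complete []          []      = tt
validV-complete (false ∷ i) (e ∷ u) = ∧-join (validE-complete e) (validV-complete i u)
validV-complete (true ∷ i)  (e ∷ u) = ∧-join (validE-complete e) (validV-complete i u)

width-codeV : ∀ {m k} (i : Vec Bool k) (u : Vec (Expr ℕ m) k) → width (codeV i u) ≡ k
width-codeV []      []      = refl
width-codeV (_ ∷ i) (_ ∷ u) = cong suc (width-codeV i u)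

validR-complete : ∀ s → T (validR (codeR s))
validR-complete (system {m} o i u) =
  subst (λ k → T ((toℕ o <ᵇ k) ∧ validV k (codeV i u))) (sym (width-codeV i u))
        (∧-join (<⇒<ᵇ (toℕ<n o)) (validV-complete i u))

-- Gates and filling on codes

-- One recursion serves expressions, vectors and systems. Below the labels 2, 3 and 6 the left
-- subtree is a numeral, whose label is a number and not a tag, so the recursion must not enter it.
gatesT : Tree → List ℕ
gatesT leaf         = []
gatesT (node n l r) =
  if n ≡ᵇ 2 then [] else
  if n ≡ᵇ 3 then topLabel l ∷ [] else
  if n ≡ᵇ 6 then gatesT r else gatesT l ++ gatesT r

gatesT-codeE : ∀ {m} (e : Expr ℕ m) → gatesT (codeE e) ≡ gatesE e
gatesT-codeE void       = refl
gatesT-codeE (var i)    = refl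
gatesT-codeE (cross e)  = trans (++-identityʳ _) (gatesT-codeE e)
gatesT-codeE (juxt e f) = cong₂ _++_ (gatesT-codeE e) (gatesT-codeE f)
gatesT-codeE (ask q)    = refl

gatesT-codeV : ∀ {m k} (i : Vec Bool k) (u : Vec (Expr ℕ m) k) →
               gatesT (codeV i u) ≡ gatesV u
gatesT-codeV []          []      = refl
gatesT-codeV (false ∷ i) (e ∷ u) = cong₂ _++_ (gatesT-codeE e) (gatesT-codeV i u)
gatesT-codeV (true ∷ i)  (e ∷ u) = cong₂ _++_ (gatesT-codeE e) (gatesT-codeV i u)

gatesTP : {t : Carrier Γ → Tree} → Program Γ tree t →
          Program Γ (list nat) (λ x → gatesT (t x))
gatesTP R = treeRecP {f = λ _ → gatesT} R nilP
  (ifP (equalP treeLabel (litP 2)) nilP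
  (ifP (equalP treeLabel (litP 3)) (consP (topLabelP treeLeft) nilP)
  (ifP (equalP treeLabel (litP 6)) rightVal (appendP leftVal rightVal))))

toComputable : {A : Set} {σ τ : Sort} {enc : A → Val σ} {g : A → Val τ} →
               Program (rep A σ enc) τ g → Computable σ τ enc g
toComputable P = code P , runs P

gatesR-computable : Computable tree (list nat) codeR gatesR
gatesR-computable = toComputable {enc = codeR}
  (convert (λ s → gatesT-codeV (System.init s) (System.update s)) (gatesTP input))

fillT : List ℕ → Tree → Tree
fillT M leaf         = leaf
fillT M (node n l r) =
  if n ≡ᵇ 2 then node n l r else
  -- `node 0 leaf leaf` and `leaf` are the codes of `cross void` and `void`, the two constants.
  if n ≡ᵇ 3 then (if marks M (topLabel l) then node 0 leaf leaf else leaf) else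
  if n ≡ᵇ 6 then node n l (fillT M r) else node n (fillT M l) (fillT M r)

-- Arbitrary `f` covers the absurd function inside `embedR` without inspecting it.
module _ (M : List ℕ) (f : ∀ {k} → ⊥ → Expr ℕ k) where

  fillT-codeE : ∀ {m} (e : Expr ℕ m) →
    fillT M (codeE e) ≡ codeE (substE f (substE (λ q → const (marks M q)) e))
  fillT-codeE void       = refl
  fillT-codeE (var i)    = refl
  fillT-codeE (cross e)  = cong (λ t → node 0 t leaf) (fillT-codeE e)
  fillT-codeE (juxt e e′) = cong₂ (node 1) (fillT-codeE e) (fillT-codeE e′)
  fillT-codeE (ask q) with marks M q
  ... | false = refl
  ... | true  = refl

  fillT-codeV : ∀ {m k} (i : Vec Bool k) (u : Vec (Expr ℕ m) k) →
    fillT M (codeV i u) ≡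
    codeV i (mapᵛ (substE f) (mapᵛ (substE (λ q → const (marks M q))) u))
  fillT-codeV []          []      = refl
  fillT-codeV (false ∷ i) (e ∷ u) = cong₂ (node 4) (fillT-codeE e) (fillT-codeV i u)
  fillT-codeV (true ∷ i)  (e ∷ u) = cong₂ (node 5) (fillT-codeE e) (fillT-codeV i u)

fillTP : {M : Carrier Γ → List ℕ} {t : Carrier Γ → Tree} → Program Γ (list nat) M →
         Program Γ tree t → Program Γ tree (λ x → fillT (M x) (t x))
fillTP {M = M} W R = treeRecP {f = λ x → fillT (M x)} R leafP
  (ifP (equalP treeLabel (litP 2)) (nodeP treeLabel treeLeft treeRight)
  (ifP (equalP treeLabel (litP 3))
       (ifP (marksP (treePar W) (topLabelP treeLeft)) (nodeP (litP 0) leafP leafP) leafP)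
  (ifP (equalP treeLabel (litP 6)) (nodeP treeLabel treeLeft rightVal)
       (nodeP treeLabel leftVal rightVal))))

fillRP : {s : Carrier Γ → System ℕ} {M : Carrier Γ → List ℕ} →
         Program Γ tree (λ x → codeR (s x)) → Program Γ (list nat) M →
         Program Γ tree (λ x → codeR (embedR (fillR (s x) (marks (M x)))))
fillRP {s = s} {M} S W = convert
  (λ x → cong (node 6 (numeral (toℕ (System.observed (s x)))))
              (fillT-codeV (M x) _ (System.init (s x)) (System.update (s x))))
  (fillTP W S)

fillR-computable : Computable {System ℕ × List ℕ} (tree ⊗ list nat) tree
                     (λ (s , M) → codeR s , M)
                     (λ (s , M) → codeR (embedR (fillR s (marks M))))
fillR-computable = toComputable {enc = λ (s , M) → codeR s , M}
  (fillRP {s = proj₁} (fstP input) (sndP input))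

toDecidable : {A : Set} {σ : Sort} {enc : A → Val σ} {X : A → Set} {b : A → Bool} →
              Test (rep A σ enc) b → (∀ x → b x ≡ true → X x) →
              (∀ x → b x ≡ false → ¬ X x) → DecidableBy σ enc X
toDecidable {enc = enc} {X} {b} B sound complete =
  code B , λ x → answer x (b x) refl (runs B x)
  where
  answer : ∀ x c → b x ≡ c → ⟦ code B ⟧ (enc x) (bit c) →
           (X x × ⟦ code B ⟧ (enc x) 1) ⊎ (¬ X x × ⟦ code B ⟧ (enc x) 0)
  answer x true  e h = inj₁ (sound x e , h)
  answer x false e h = inj₂ (complete x e , h)

valid-decidable : DecidableBy tree id (λ t → ∃[ s ] codeR s ≡ t)
valid-decidable = toDecidable {enc = id} (validRP input)
  (λ t e → validR-sound t (Equivalence.from T-≡ e))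
  (λ { t e (s , refl) → subst T e (validR-complete s) })

-- Deciding manifestation

headOr : {A : Set} → A → List A → A
headOr d []      = d
headOr d (x ∷ _) = x

tailOf : {A : Set} → List A → List A
tailOf []      = []
tailOf (_ ∷ w) = w

headOrP : {σ : Sort} {d : Val σ} {w : Carrier Γ → List (Val σ)} → Program Γ σ (λ _ → d) →
          Program Γ (list σ) w → Program Γ σ (λ x → headOr d (w x))
headOrP {d = d} E W = listRecP {f = λ _ → headOr d} W E listHead

tailOfP : {σ : Sort} {w : Carrier Γ → List (Val σ)} → Program Γ (list σ) w →
          Program Γ (list σ) (λ x → tailOf (w x))
tailOfP W = listRecP {f = λ _ → tailOf} W nilP listTail

dropped : List ℕ → ℕ → List ℕ
dropped w zero    = w
dropped w (suc n) = tailOf (dropped w n)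

entry : List ℕ → ℕ → Bool
entry w n = positive (headOr 0 (dropped w n))

entryP : {w : Carrier Γ → List ℕ} {n : Carrier Γ → ℕ} → Program Γ (list nat) w →
         Program Γ nat n → Test Γ (λ x → entry (w x) (n x))
entryP {w = w} W N =
  positiveP (headOrP (litP 0) (natRecP {f = λ x → dropped (w x)} N W (tailOfP natVal)))

bits : ∀ {m} → Vec Bool m → List ℕ
bits []      = []
bits (b ∷ v) = bit b ∷ bits v

length-bits : ∀ {m} (v : Vec Bool m) → length (bits v) ≡ m
length-bits []      = refl
length-bits (_ ∷ v) = cong suc (length-bits v)

entry-bits : ∀ {m} (v : Vec Bool m) i → entry (bits v) (toℕ i) ≡ lookupᵛ v i
entry-bits (false ∷ v) zero = refl
entry-bits (true ∷ v)  zero = refl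
entry-bits (b ∷ v) (suc i)  =
  trans (cong (λ w → positive (headOr 0 w)) (dropped-∷ (toℕ i))) (entry-bits v i)
  where
  dropped-∷ : ∀ n → dropped (bits (b ∷ v)) (suc n) ≡ dropped (bits v) n
  dropped-∷ zero    = refl
  dropped-∷ (suc n) = cong tailOf (dropped-∷ n)

evalT : List ℕ → Tree → Bool
evalT w leaf         = false
evalT w (node n l r) =
  if n ≡ᵇ 0 then not (evalT w l) else
  if n ≡ᵇ 1 then evalT w l ∨ evalT w r else
  -- The default stands for `ask`, which the code of an embedded system never contains.
  if n ≡ᵇ 2 then entry w (topLabel l) else false

stepT : List ℕ → Tree → List ℕ
stepT w leaf         = []
stepT w (node _ l r) = bit (evalT w l) ∷ stepT w r

-- The labels of initial values are 4 for void and 5 for mark.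

initT : Tree → List ℕ
initT leaf         = []
initT (node n _ r) = n ∸ 4 ∷ initT r

orbitT : Tree → ℕ → List ℕ
orbitT t zero    = initT t
orbitT t (suc k) = stepT (orbitT t k) t

-- States repeat within `2 ^ size` steps, so a search bounded by this number is complete. The size
-- is read off as the length of the initial state.
marksWithin : Tree → Bool
marksWithin t =
  not (allBelow (λ k → not (entry (orbitT (rightTree t) k) (topLabel (leftTree t))))
                (2 ^ length (initT (rightTree t))))

evalTP : {w : Carrier Γ → List ℕ} {t : Carrier Γ → Tree} → Program Γ (list nat) w →
         Program Γ tree t → Test Γ (λ x → evalT (w x) (t x))
evalTP {w = w} W R = treeRecP {f = λ x t → bit (evalT (w x) t)} R falseP
  (ifᵇP (equalP treeLabel (litP 0)) (notP leftVal)
  (ifᵇP (equalP treeLabel (litP 1)) (orP leftVal rightVal)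
  (ifᵇP (equalP treeLabel (litP 2)) (entryP (treePar W) (topLabelP treeLeft)) falseP)))

stepTP : {w : Carrier Γ → List ℕ} {t : Carrier Γ → Tree} → Program Γ (list nat) w →
         Program Γ tree t → Program Γ (list nat) (λ x → stepT (w x) (t x))
stepTP {w = w} W R = treeRecP {f = λ x → stepT (w x)} R nilP
  (consP (evalTP (treePar W) treeLeft) rightVal)

initTP : {t : Carrier Γ → Tree} → Program Γ tree t →
         Program Γ (list nat) (λ x → initT (t x))
initTP R = treeRecP {f = λ _ → initT} R nilP (consP (monusP treeLabel (litP 4)) rightVal)

orbitTP : {t : Carrier Γ → Tree} {k : Carrier Γ → ℕ} →
          Program Γ tree t → Program Γ nat k →
          Program Γ (list nat) (λ x → orbitT (t x) (k x))
orbitTP {t = t} R K = natRecP {f = λ x → orbitT (t x)} K (initTP R)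
  (stepTP natVal (natPar R))

marksWithinP : {t : Carrier Γ → Tree} → Program Γ tree t →
               Test Γ (λ x → marksWithin (t x))
marksWithinP R = notP (allBelowP
  (notP (entryP (orbitTP (par (rightTreeP R)) idx) (par (topLabelP (leftTreeP R)))))
  (powerP (lengthP (initTP (rightTreeP R)))))

module _ (f : ∀ {k} → ⊥ → Expr ℕ k) where

  evalT-codeE : ∀ {m} (v : Vec Bool m) (e : Expr ⊥ m) →
                evalT (bits v) (codeE (substE f e)) ≡ eval v e
  evalT-codeE v void       = refl
  evalT-codeE v (var i)    = entry-bits v i
  evalT-codeE v (cross e)  = cong not (evalT-codeE v e)
  evalT-codeE v (juxt e g) = cong₂ _∨_ (evalT-codeE v e) (evalT-codeE v g)

  stepT-codeV : ∀ {m k} (v : Vec Bool m) (i : Vec Bool k) (u : Vec (Expr ⊥ m) k) →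
                stepT (bits v) (codeV i (mapᵛ (substE f) u)) ≡ bits (mapᵛ (eval v) u)
  stepT-codeV v []      []      = refl
  stepT-codeV v (b ∷ i) (e ∷ u) = cong₂ _∷_ (cong bit (evalT-codeE v e)) (stepT-codeV v i u)

  initT-codeV : ∀ {m k} (i : Vec Bool k) (u : Vec (Expr ⊥ m) k) →
                initT (codeV i (mapᵛ (substE f) u)) ≡ bits i
  initT-codeV []          []      = refl
  initT-codeV (false ∷ i) (e ∷ u) = cong (0 ∷_) (initT-codeV i u)
  initT-codeV (true ∷ i)  (e ∷ u) = cong (1 ∷_) (initT-codeV i u)

  orbitT-codeR : ∀ S k → orbitT (rightTree (codeR (substS f S))) k ≡ bits (state S k)
  orbitT-codeR (system o i u)   zero    = initT-codeV i u
  orbitT-codeR S@(system o i u) (suc k) =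
    trans (cong (λ w → stepT w (codeV i (mapᵛ (substE f) u))) (orbitT-codeR S k))
          (stepT-codeV (state S k) i u)

lookup-ext : ∀ {m} {v w : Vec Bool m} → lookupᵛ v ≗ lookupᵛ w → v ≡ w
lookup-ext {v = v} {w} h =
  trans (sym (tabulate∘lookup v)) (trans (tabulate-cong h) (tabulate∘lookup w))

observes : System ⊥ → ℕ → Bool
observes S k = lookupᵛ (state S k) (System.observed S)

-- A stage at or beyond transient plus period has the same state as the stage one period earlier;
-- the descent ends below `t + π`, hence below `2 ^ size`.
early : ∀ S k → ∃[ j ] (j < 2 ^ System.size S × state S j ≡ state S k)
early S k with recurrence (λ k → lookupᵛ (state S k)) (λ i j h l →
    cong (λ v → lookupᵛ (mapᵛ (eval v) (System.update S)) l) (lookup-ext {v = state S i} h))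
... | t , π , 0<π , bound , per = go k (<-wellFounded k)
  where
  go : ∀ k → Acc _<_ k → ∃[ j ] (j < 2 ^ System.size S × state S j ≡ state S k)
  go k (acc rec) with k <? t + π
  ... | yes k< = k , <-≤-trans k< bound , refl
  ... | no  k≮ =
    let t+π≤k = ≮⇒≥ k≮
        π≤k = m+n≤o⇒n≤o t t+π≤k
        j , j< , e = go (k ∸ π) (rec (∸-monoʳ-< {k} {π} {0} 0<π π≤k))
        earlier = lookup-ext {v = state S (k ∸ π + π)}
                             (per (k ∸ π) (m+n≤o⇒m≤o∸n t t+π≤k))
    in j , j< , trans e (trans (sym earlier) (cong (state S) (m∸n+n≡m π≤k)))

allBelow-false : ∀ {b} n → allBelow b n ≡ false → ∃[ k ] b k ≡ false
allBelow-false {b} (suc n) e with b n in bn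
... | false = n , bn
... | true  = allBelow-false n e

allBelow-cong : ∀ {b c : ℕ → Bool} n → (∀ k → b k ≡ c k) → allBelow b n ≡ allBelow c n
allBelow-cong zero    h = refl
allBelow-cong (suc n) h = cong₂ _∧_ (h n) (allBelow-cong n h)

marksWithin-codeR : (f : ∀ {k} → ⊥ → Expr ℕ k) → ∀ S →
                    marksWithin (codeR (substS f S)) ≡
                    not (allBelow (λ k → not (observes S k)) (2 ^ System.size S))
marksWithin-codeR f S@(system o i u) = cong not (trans
  (cong (allBelow _) (cong (2 ^_) (trans (cong length (initT-codeV f i u)) (length-bits i))))
  (allBelow-cong (2 ^ System.size S) λ k → cong not
    (trans (cong (λ w → entry w (toℕ o)) (orbitT-codeR f S k))
           (entry-bits (state S k) o))))

not-true : ∀ {b} → not b ≡ true → b ≡ false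
not-true {false} _ = refl

not-false : ∀ {b} → not b ≡ false → b ≡ true
not-false {true} _ = refl

marks-decidable : Decidable ReEntry
marks-decidable = toDecidable {enc = λ s → codeR (embedR s)}
  (convert (λ S → cong bit (marksWithin-codeR _ S)) (marksWithinP input))
  sound complete
  where
  b : System ⊥ → Bool
  b S = not (allBelow (λ k → not (observes S k)) (2 ^ System.size S))
  sound : ∀ S → b S ≡ true → Marks S
  sound S e = let k , h = allBelow-false (2 ^ System.size S) (not-true e) in k , not-false h
  complete : ∀ S → b S ≡ false → ¬ Marks S
  complete S e (k , h) with early S k
  ... | j , j< , same-state with () ← trans (sym h)
          (trans (cong (λ v → lookupᵛ v (System.observed S)) (sym same-state))
                 (not-true (allBelow-sound (2 ^ System.size S) (not-false e) j j<)))

-- The numbering of re-entry systems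

-- A step along Cantor's diagonals: the sum is kept until the second component runs out, then the
-- next diagonal starts. Iterating it makes `unpair` primitive recursive, and `triangle d` is where
-- diagonal `d` begins.
next : ℕ × ℕ → ℕ × ℕ
next (i , zero)  = 0 , suc i
next (i , suc r) = suc i , r

unpair : ℕ → ℕ × ℕ
unpair zero    = 0 , 0
unpair (suc n) = next (unpair n)

triangle : ℕ → ℕ
triangle zero    = 0
triangle (suc d) = suc d + triangle d

pair : ℕ → ℕ → ℕ
pair i r = i + triangle (i + r)

unpair-triangle : ∀ d → unpair (triangle d) ≡ (0 , d)
unpair-diagonal : ∀ d i r → i + r ≡ d → unpair (i + triangle d) ≡ (i , r)

unpair-triangle zero    = refl
unpair-triangle (suc d) = cong next (unpair-diagonal d d 0 (+-identityʳ d))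

unpair-diagonal d zero    r refl = unpair-triangle d
unpair-diagonal d (suc i) r e    =
  cong next (unpair-diagonal d i (suc r) (trans (+-suc i r) e))

unpair-pair : ∀ i r → unpair (pair i r) ≡ (i , r)
unpair-pair i r = unpair-diagonal (i + r) i r refl

-- A number is read as a program for a stack machine: each step splits off
-- one instruction, 0 pushing a leaf and suc n joining the two topmost trees
-- under a node labelled n.

push : ℕ → List Tree → List Tree
push zero    w = leaf ∷ w
push (suc n) w = node n (headOr leaf (tailOf w)) (headOr leaf w) ∷ tailOf (tailOf w)

execute : ℕ × List Tree → ℕ × List Tree
execute (q , w) = proj₂ (unpair q) , push (proj₁ (unpair q)) w

executes : ℕ → ℕ × List Tree → ℕ × List Tree
executes zero    c = c
executes (suc n) c = execute (executes n c)

treeAt : ℕ → Tree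
treeAt p = headOr leaf (proj₂ (executes (proj₁ (unpair p)) (proj₂ (unpair p) , [])))

executes-+ : ∀ n m c → executes (n + m) c ≡ executes n (executes m c)
executes-+ zero    m c = refl
executes-+ (suc n) m c = cong execute (executes-+ n m c)

execute-pair : ∀ k q w → execute (pair k q , w) ≡ (q , push k w)
execute-pair k q w = cong (λ (j , q) → q , push j w) (unpair-pair k q)

-- `q` is what remains to be executed afterwards, so instructions are prepended back to front: the
-- join, then those for `r`, then those for `l`. The stack `w` is general because `r` runs on top of
-- `l`.
compile : ∀ t q w → ∃[ n ] ∃[ q′ ] executes n (q′ , w) ≡ (q , t ∷ w)
compile leaf q w = 1 , pair 0 q , execute-pair 0 q w
compile (node k l r) q w with compile r (pair (suc k) q) (l ∷ w)
... | nr , qr , er with compile l qr w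
... | nl , ql , el = suc (nr + nl) , ql ,
  trans (cong execute (trans (executes-+ nr nl _) (trans (cong (executes nr) el) er)))
        (execute-pair (suc k) q (r ∷ l ∷ w))

treeAt-surjective : ∀ t → ∃[ p ] treeAt p ≡ t
treeAt-surjective t with compile t 0 []
... | n , q , e = pair n q , cong (headOr leaf ∘ proj₂)
  (trans (cong (λ (n , q) → executes n (q , [])) (unpair-pair n q)) e)

unpairP : {p : Carrier Γ → ℕ} → Program Γ nat p →
          Program Γ (nat ⊗ nat) (λ x → unpair (p x))
unpairP K = natRecP {f = λ _ → unpair} K (pairP (litP 0) (litP 0)) (nextP natVal)
  where
  nextP : {g : Carrier Γ → ℕ × ℕ} → Program Γ (nat ⊗ nat) g →
          Program Γ (nat ⊗ nat) (λ x → next (g x))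
  nextP {g = g} G = natRecP {f = λ x r → next (proj₁ (g x) , r)} (sndP G)
    (pairP (litP 0) (sucP (fstP G))) (pairP (sucP (fstP (natPar G))) natIdx)

triangleP : {p : Carrier Γ → ℕ} → Program Γ nat p →
            Program Γ nat (λ x → triangle (p x))
triangleP K = natRecP {f = λ _ → triangle} K (litP 0) (addP (sucP natIdx) natVal)

treeAtP : {p : Carrier Γ → ℕ} → Program Γ nat p → Program Γ tree (λ x → treeAt (p x))
treeAtP {p = p} K = headOrP leafP (sndP (natRecP
  {f = λ x n → executes n (proj₂ (unpair (p x)) , [])} (fstP (unpairP K))
  (pairP (sndP (unpairP K)) nilP)
  (pairP (sndP (unpairP (fstP natVal)))
         (pushP (fstP (unpairP (fstP natVal))) (sndP natVal)))))
  where
  pushP : {k : Carrier Γ → ℕ} {w : Carrier Γ → List Tree} → Program Γ nat k →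
          Program Γ (list tree) w → Program Γ (list tree) (λ x → push (k x) (w x))
  pushP {w = w} N W = natRecP {f = λ x k → push k (w x)} N (consP leafP W)
    (consP (nodeP natIdx (headOrP leafP (tailOfP (natPar W))) (headOrP leafP (natPar W)))
           (tailOfP (tailOfP (natPar W))))

constP : (t : Tree) → Program Γ tree (λ _ → t)
constP leaf         = leafP
constP (node n l r) = nodeP (litP n) (constP l) (constP r)

trivial : System ℕ
trivial = system {size = 1} zero (false ∷ []) (void ∷ [])

-- Invalid trees name the default `trivial`, which makes the numbering total. The Boolean is an
-- argument so that proofs can match on it.
toSystem : ∀ t b → validR t ≡ b → System ℕ
toSystem t true  e = proj₁ (validR-sound t (Equivalence.from T-≡ e))
toSystem t false e = trivial

codeR-toSystem : ∀ t b (e : validR t ≡ b) →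
                 codeR (toSystem t b e) ≡ (if b then t else codeR trivial)
codeR-toSystem t true  e = proj₂ (validR-sound t (Equivalence.from T-≡ e))
codeR-toSystem t false e = refl

systemAt : ℕ → System ℕ
systemAt p = toSystem (treeAt p) _ refl

systemAt-surjective : ∀ s → ∃[ p ] systemAt p ≡ s
systemAt-surjective s with treeAt-surjective (codeR s)
... | p , e = p , Domain.⌜⌝-inj ReEntry (trans (codeR-toSystem (treeAt p) _ refl)
  (trans (cong (λ b → if b then treeAt p else codeR trivial)
               (trans (cong validR e) (Equivalence.to T-≡ (validR-complete s)))) e))

systemAtP : {p : Carrier Γ → ℕ} → Program Γ nat p →
            Program Γ tree (λ x → codeR (systemAt (p x)))
systemAtP {p = p} K = convert (λ x → sym (codeR-toSystem (treeAt (p x)) _ refl))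
  (ifP (validRP (treeAtP K)) (treeAtP K) (constP (codeR trivial)))

-- Bit i of the counter flips when all lower bits are set, except that every
-- bit is reset when all but the lowest are set.  The system for bit j has
-- index triangle (b + j), which is pair 0 (b + j), where b = triangle d.

someClear : ℕ → ℕ → Expr ℕ 1
someClear b zero    = void
someClear b (suc j) = juxt (cross (ask (triangle (b + j)))) (someClear b j)

-- Negated, because the iterates negate the outcome of a system.

nextBitNegated : ℕ → ℕ → ℕ → Expr ℕ 1
nextBitNegated b i d =
  juxt (cross (someClear (suc b) d))
       (juxt (cross (juxt (cross (someClear b i)) (ask (triangle (b + i)))))
             (cross (juxt (someClear b i) (cross (ask (triangle (b + i)))))))

-- The single coordinate starts void and has the value of `e` from stage 1 on; if that value does
-- not depend on the state, the system manifests exactly when it is mark.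
oneShot : Expr ℕ 1 → System ℕ
oneShot e = system zero (false ∷ []) (e ∷ [])

counterBit : ℕ → System ℕ
counterBit p =
  let i , r = unpair p in oneShot (nextBitNegated (triangle (i + r)) i (i + r))

-- Tag 0 carries the counters, whose indices are thereby known in advance; tag 1 makes `pair 1` an
-- effective inclusion of `ν₀`; the remaining tags keep the numbering surjective.
choose : ℕ → ℕ → System ℕ
choose zero          e = counterBit e
choose (suc zero)    e = embedR (fillR (systemAt e) (marks []))
choose (suc (suc _)) e = systemAt e

counterBitP : {p : Carrier Γ → ℕ} → Program Γ nat p →
              Program Γ tree (λ x → codeR (counterBit (p x)))
counterBitP {Γ = Γ} {p = p} K =
  nodeP (litP 6) (constP (numeral 0)) (nodeP (litP 4)
    (juxtP (crossP (someClearP (sucP B) D))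
           (juxtP (crossP (juxtP (crossP (someClearP B I)) (askP (addP B I))))
                  (crossP (juxtP (someClearP B I) (crossP (askP (addP B I)))))))
    leafP)
  where
  crossP : ∀ {Γ} {u : Carrier Γ → Tree} → Program Γ tree u →
           Program Γ tree (λ x → node 0 (u x) leaf)
  crossP U = nodeP (litP 0) U leafP
  juxtP : ∀ {Γ} {u v : Carrier Γ → Tree} → Program Γ tree u → Program Γ tree v →
          Program Γ tree (λ x → node 1 (u x) (v x))
  juxtP = nodeP (litP 1)
  askP : ∀ {Γ} {q : Carrier Γ → ℕ} → Program Γ nat q →
         Program Γ tree (λ x → codeE (ask {m = 1} (triangle (q x))))
  askP Q = nodeP (litP 3) (nodeP (triangleP Q) leafP leafP) leafP
  someClearP : {b i : Carrier Γ → ℕ} → Program Γ nat b → Program Γ nat i →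
               Program Γ tree (λ x → codeE (someClear (b x) (i x)))
  someClearP {b = b} B I = natRecP {f = λ x i → codeE (someClear (b x) i)} I leafP
    (juxtP (crossP (askP (addP (natPar B) natIdx))) natVal)
  I : Program Γ nat (λ x → proj₁ (unpair (p x)))
  I = fstP (unpairP K)
  D : Program Γ nat (λ x → proj₁ (unpair (p x)) + proj₂ (unpair (p x)))
  D = addP I (sndP (unpairP K))
  B : Program Γ nat (λ x → triangle (proj₁ (unpair (p x)) + proj₂ (unpair (p x))))
  B = triangleP D

chooseP : {c e : Carrier Γ → ℕ} → Program Γ nat c → Program Γ nat e →
          Program Γ tree (λ x → codeR (choose (c x) (e x)))
chooseP {c = c} {e} C E = convert agrees
  (ifP (equalP C (litP 0)) (counterBitP E)
  (ifP (equalP C (litP 1)) (fillRP {s = systemAt ∘ e} (systemAtP E) nilP) (systemAtP E)))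
  where
  agrees : ∀ x → (if c x ≡ᵇ 0 then codeR (counterBit (e x)) else
                  if c x ≡ᵇ 1 then codeR (embedR (fillR (systemAt (e x)) (marks []))) else
                  codeR (systemAt (e x))) ≡ codeR (choose (c x) (e x))
  agrees x with c x
  ... | zero        = refl
  ... | suc zero    = refl
  ... | suc (suc _) = refl

numbered : ℕ → System ℕ
numbered p = choose (proj₁ (unpair p)) (proj₂ (unpair p))

numbered-pair : ∀ c e → numbered (pair c e) ≡ choose c e
numbered-pair c e = cong (λ (c , e) → choose c e) (unpair-pair c e)

presentation : Presentation ReEntry
presentation = record
  { L⁺-decidable  = valid-decidable
  ; gates-comp    = gatesR-computable
  ; fill-comp     = fillR-computable
  -- Voiding all gates turns every index into one of a gate-free system and leaves systems without
  -- gates unchanged, whence surjectivity.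
  ; ν₀            = λ e → fillR (systemAt e) (marks [])
  ; ν₀-surjective = λ s → let e , h = systemAt-surjective (embedR s) in
      e , λ { refl → trans (cong (λ t → fillR t (marks [])) h)
                           (Domain.fill-embed ReEntry s (marks [])) }
  ; ν₀-comp       = toComputable {enc = id} (fillRP {s = systemAt} (systemAtP input) nilP)
  ; ν             = numbered
  ; ν-surjective  = λ s → let e , h = systemAt-surjective s in
      pair 2 e , λ { refl → trans (numbered-pair 2 e) h }
  ; ν-comp        = toComputable {enc = id}
      (chooseP (fstP (unpairP input)) (sndP (unpairP input)))
  ; index         = pair 1
  -- `pair 1 e` unfolds to `suc (triangle (suc e))`.
  ; index-comp    = toComputable {enc = id} (sucP (triangleP (sucP input)))
  ; ν-extends     = numbered-pair 1
  }

-- The period of a binary counter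

bit≤1 : ∀ b → bit b ≤ 1
bit≤1 false = z≤n
bit≤1 true  = ≤-refl

<ᵇ-true : ∀ {m n} → m < n → (m <ᵇ n) ≡ true
<ᵇ-true m<n = Equivalence.to T-≡ (<⇒<ᵇ m<n)

<ᵇ-false : ∀ {m n} → n ≤ m → (m <ᵇ n) ≡ false
<ᵇ-false {m} {n} n≤m with m <ᵇ n in e
... | false = refl
... | true  = ⊥-elim (<⇒≱ (<ᵇ⇒< m n (Equivalence.from T-≡ e)) n≤m)

anyClear : (ℕ → Bool) → ℕ → Bool
anyClear x zero    = false
anyClear x (suc i) = not (x i) ∨ anyClear x i

flipBit : (ℕ → Bool) → ℕ → Bool
flipBit x i = if anyClear x i then x i else not (x i)

-- Ripple-carry successor, forced to zero when bits 1 to `d` are all set, that is, at the values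
-- `2 ^ suc d ∸ 2` and `2 ^ suc d ∸ 1`.
nextBit : ℕ → (ℕ → Bool) → ℕ → Bool
nextBit d x i = anyClear (x ∘ suc) d ∧ flipBit x i

anyClear-cong : ∀ {x y} i → (∀ j → x j ≡ y j) → anyClear x i ≡ anyClear y i
anyClear-cong zero    h = refl
anyClear-cong (suc i) h = cong₂ (λ b c → not b ∨ c) (h i) (anyClear-cong i h)

anyClear-shift : ∀ x d → anyClear (x ∘ suc) d ≡ true → anyClear x (suc d) ≡ true
anyClear-shift x (suc d) e with x (suc d)
... | false = refl
... | true  = anyClear-shift x d e

binary : (ℕ → Bool) → ℕ → ℕ
binary x zero    = 0
binary x (suc m) = binary x m + bit (x m) * 2 ^ m

binary-cong : ∀ {x y} m → (∀ i → i < m → x i ≡ y i) → binary x m ≡ binary y m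
binary-cong zero    h = refl
binary-cong (suc m) h =
  cong₂ (λ n b → n + bit b * 2 ^ m) (binary-cong m (λ i → h i ∘ m<n⇒m<1+n)) (h m ≤-refl)

binary-false : ∀ m → binary (λ _ → false) m ≡ 0
binary-false zero    = refl
binary-false (suc m) = trans (+-identityʳ _) (binary-false m)

binary-< : ∀ x m → binary x m < 2 ^ m
binary-< x zero = s≤s z≤n
binary-< x (suc m) = +-mono-<-≤ (binary-< x m) (*-monoˡ-≤ (2 ^ m) (bit≤1 (x m)))

-- `binary` peels off the top bit, whereas the reset test looks at all bits but the lowest, so the
-- lowest has to be split off as well.
binary-low : ∀ x m → binary x (suc m) ≡ bit (x 0) + 2 * binary (x ∘ suc) m
binary-low x zero    = trans (*-identityʳ (bit (x 0))) (sym (+-identityʳ (bit (x 0))))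
binary-low x (suc m) = begin
  binary x (suc m) + c * (2 * p)          ≡⟨ cong (_+ c * (2 * p)) (binary-low x m) ⟩
  bit (x 0) + 2 * w + c * (2 * p)         ≡⟨ +-assoc (bit (x 0)) (2 * w) _ ⟩
  bit (x 0) + (2 * w + c * (2 * p))       ≡⟨ cong (λ n → bit (x 0) + (2 * w + n))
                                                  (x∙yz≈y∙xz c 2 p) ⟩
  bit (x 0) + (2 * w + 2 * (c * p))       ≡⟨ cong (bit (x 0) +_) (*-distribˡ-+ 2 w (c * p)) ⟨
  bit (x 0) + 2 * (w + c * p)             ∎
  where
  open ≡-Reasoning
  c = bit (x (suc m))
  p = 2 ^ m
  w = binary (x ∘ suc) m

binary-full : ∀ x m → anyClear x m ≡ false → suc (binary x m) ≡ 2 ^ m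
binary-full x zero    e = refl
binary-full x (suc m) e with x m
... | true = cong₂ _+_ (binary-full x m e) refl

binary-flip : ∀ x m → binary (flipBit x) m ≡ (if anyClear x m then suc (binary x m) else 0)
binary-flip x zero = refl
binary-flip x (suc m) with anyClear x m in e | x m | binary-flip x m
... | true  | false | h = cong (_+ 0) h
... | true  | true  | h = cong (_+ (2 ^ m + 0)) h
... | false | true  | h = trans (+-identityʳ _) h
... | false | false | h = trans (cong (_+ (2 ^ m + 0)) h)
  (trans (+-identityʳ (2 ^ m)) (trans (sym (binary-full x m e)) (sym (+-identityʳ _))))

binary-top : ∀ x d → x d ≡ not (binary x (suc d) <ᵇ 2 ^ d)
binary-top x d with x d
... | false = cong not (sym (<ᵇ-true
                (subst (_< 2 ^ d) (sym (+-identityʳ _)) (binary-< x d))))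
... | true  = cong not (sym (<ᵇ-false
                (≤-trans (m≤m+n (2 ^ d) 0) (m≤n+m _ (binary x d)))))

-- Wraps from `h ∸ 2` to 0, one value earlier than a full counter with `h` states.
increment : ℕ → ℕ → ℕ
increment h v = if suc (suc v) <ᵇ h then suc v else 0

-- The value is its lowest bit plus `2 * w`. Some higher bit is clear exactly if `suc w < 2 ^ d`,
-- which for either lowest bit amounts to the test in `increment`.
binary-next : ∀ d x → binary (nextBit d x) (suc d) ≡
                      increment (2 ^ suc d) (binary x (suc d))
binary-next d x with anyClear (x ∘ suc) d in e
... | true = trans (binary-flip x (suc d))
  (trans (cong (λ b → if b then suc v else 0) (anyClear-shift x d e))
         (sym (cong (λ b → if b then suc v else 0) (<ᵇ-true below))))
  where
  v = binary x (suc d)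
  w = binary (x ∘ suc) d
  -- As some bit is clear, flipping turns the number `w` into `suc w`, which still has only `d`
  -- bits.
  w< : suc w < 2 ^ d
  w< = subst (_< 2 ^ d)
             (trans (binary-flip (x ∘ suc) d) (cong (λ b → if b then suc w else 0) e))
             (binary-< (flipBit (x ∘ suc)) d)
  open ≤-Reasoning
  below : suc (suc v) < 2 ^ suc d
  below = begin-strict
    suc (suc v)                 ≡⟨ cong (2 +_) (binary-low x d) ⟩
    2 + (bit (x 0) + 2 * w)     ≤⟨ +-monoʳ-≤ 2 (+-monoˡ-≤ (2 * w) (bit≤1 (x 0))) ⟩
    3 + 2 * w                   <⟨ n<1+n _ ⟩
    2 * 2 + 2 * w               ≡⟨ *-distribˡ-+ 2 2 w ⟨
    2 * (2 + w)                 ≤⟨ *-monoʳ-≤ 2 w< ⟩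
    2 * 2 ^ d                   ∎
... | false = trans (binary-false (suc d)) 
  (sym (cong (λ b → if b then suc v else 0) (<ᵇ-false h≤)))
  where
  v = binary x (suc d)
  w = binary (x ∘ suc) d
  open ≤-Reasoning
  h≤ : 2 ^ suc d ≤ suc (suc v)
  h≤ = begin
    2 * 2 ^ d                 ≡⟨ cong (2 *_) (binary-full (x ∘ suc) d e) ⟨
    2 * suc w                 ≡⟨ *-distribˡ-+ 2 1 w ⟩
    2 + 2 * w                 ≤⟨ +-monoʳ-≤ 2 (m≤n+m (2 * w) (bit (x 0))) ⟩
    2 + (bit (x 0) + 2 * w)   ≡⟨ cong (2 +_) (binary-low x d) ⟨
    suc (suc v)               ∎

-- `suc h` stands for `2 ^ d`, in a form that makes the modulus `suc h + suc h` equal to `suc π` by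
-- computation.
module _ {s : ℕ → Bool} {v : ℕ → ℕ} {h : ℕ} (start : v 0 ≡ 0)
         (tick : ∀ k → v (suc k) ≡ increment (suc h + suc h) (v k))
         (top : ∀ k → s k ≡ not (v k <ᵇ suc h)) where

  private
    π = h + suc h

  climb : ∀ k → k < π → v k ≡ k
  climb zero    _     = start
  climb (suc k) 1+k<π = trans (tick k)
    (trans (cong (increment (suc π)) (climb k (<-trans (n<1+n k) 1+k<π)))
           (cong (λ b → if b then suc k else 0) (<ᵇ-true (s≤s 1+k<π))))

  reset : v π ≡ 0
  reset = subst (λ n → v n ≡ 0) (sym (+-suc h h)) (trans (tick (h + h))
    (trans (cong (increment (suc π)) (climb (h + h) (+-monoʳ-< h (n<1+n h))))
           (cong (λ b → if b then suc (h + h) else 0)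
                 (<ᵇ-false (≤-reflexive (cong suc (+-suc h h)))))))

  counter-cycle : ∀ k → v (k + π) ≡ v k
  counter-cycle zero    = trans reset (sym start)
  counter-cycle (suc k) =
    trans (tick (k + π)) (trans (cong (increment (suc π)) (counter-cycle k)) (sym (tick k)))

  top-periodic : PeriodicFrom s 0 π
  top-periodic = ≤-trans (s≤s z≤n) (m≤n+m (suc h) h) , λ k _ →
    trans (top (k + π)) (trans
      (cong (λ n → not (n <ᵇ suc h)) (counter-cycle k)) (sym (top k)))

  -- A shorter shift moves the end of the low half, or else its beginning,
  -- into the high half.

  top-period : EventualPeriod s π
  top-period = (0 , top-periodic) , minimal
    where
    low : ∀ j → j ≤ h → s j ≡ false
    low j j≤h = trans (top j) (cong not
      (trans (cong (_<ᵇ suc h) (climb j (<-≤-trans (s≤s j≤h) (m≤n+m (suc h) h))))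
             (<ᵇ-true (s≤s j≤h))))
    high : ∀ j → h < j → j < π → s j ≡ true
    high j h<j j<π = trans (top j) (cong not
      (trans (cong (_<ᵇ suc h) (climb j j<π)) (<ᵇ-false h<j)))
    minimal : ∀ t′ π′ → PeriodicFrom s t′ π′ → π ≤ π′
    minimal t′ π′ per′ with periodic-earlier top-periodic per′ | π ≤? π′ | π′ ≤? h
    ... | _          | yes π≤π′ | _        = π≤π′
    ... | 0<π′ , eq | no π≰π′ | no π′≰h with () ←
      trans (sym (high π′ (≰⇒> π′≰h) (≰⇒> π≰π′))) (trans (eq 0 z≤n) (low 0 z≤n))
    ... | 0<π′ , eq | no π≰π′ | yes π′≤h with () ←
      trans (sym (high (h + π′) (m<m+n h 0<π′) (+-monoʳ-< h (s≤s π′≤h))))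
            (trans (eq h z≤n) (low h ≤-refl))

-- The counter as a block of re-entry systems

does-manifests : ∀ D dec s b → (b ≡ true → Domain.Manifests D s) →
                 (b ≡ false → ¬ Domain.Manifests D s) → does (manifests? D dec s) ≡ b
does-manifests D dec s true  yes! _  = dec-true (manifests? D dec s) (yes! refl)
does-manifests D dec s false _   no! = dec-false (manifests? D dec s) (no! refl)

fillE : ∀ {m} → (ℕ → Bool) → Expr ℕ m → Expr ⊥ m
fillE f = substE (λ q → const (f q))

eval-const : ∀ {m} (v : Vec Bool m) b → eval v (const b) ≡ b
eval-const v false = refl
eval-const v true  = refl

oneShot-manifests : ∀ dec e f b → (∀ v → eval v (fillE f e) ≡ b) →
                    does (manifests? ReEntry dec (fillR (oneShot e) f)) ≡ b
oneShot-manifests dec e f b h = does-manifests ReEntry dec (fillR (oneShot e) f) b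
  (λ b≡true → 1 , trans (h _) b≡true)
  (λ { refl (zero , ()) ; refl (suc t , e′) → case trans (sym (h _)) e′ of λ () })

eval-someClear : ∀ f b i v → eval v (fillE f (someClear b i)) ≡
                             anyClear (λ j → f (triangle (b + j))) i
eval-someClear f b zero    v = refl
eval-someClear f b (suc i) v =
  cong₂ (λ c d → not c ∨ d) (eval-const v _) (eval-someClear f b i v)

-- With `w` for the reset test, `z` for a clear bit below `i` and `x` for bit `i`, the expression is
-- `not w` or the exclusive disjunction of `z` and `x`; `table` checks that this negates the counter
-- step.
eval-nextBit : ∀ f b i d v → eval v (fillE f (nextBitNegated b i d)) ≡
               not (nextBit d (λ j → f (triangle (b + j))) i)
eval-nextBit f b i d v
  rewrite eval-someClear f (suc b) d v | eval-someClear f b i v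
        | eval-const v (f (triangle (b + i)))
        | anyClear-cong {λ j → f (triangle (suc b + j))} {λ j → f (triangle (b + suc j))} d
            (λ j → cong (f ∘ triangle) (sym (+-suc b j)))
  = table (anyClear (λ j → f (triangle (b + suc j))) d)
          (anyClear (λ j → f (triangle (b + j))) i) (f (triangle (b + i)))
  where
  table : ∀ w z x → not w ∨ (not (not z ∨ x) ∨ not (z ∨ not x)) ≡
                    not (w ∧ (if z then x else not x))
  table false z     x     = refl
  table true  false false = refl
  table true  false true  = refl
  table true  true  false = refl
  table true  true  true  = refl

module Counter (d : ℕ) where

  bitNode : ℕ → ℕ
  bitNode j = triangle (triangle d + j)

  x : ℕ → ℕ → Bool
  x k j = iterates presentation marks-decidable k (bitNode j)

  -- Position `i` on diagonal `d` unpairs to `i` and `d ∸ i`, so a system finds both its bit and its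
  -- block in its own index.
  numbered-node : ∀ i → i ≤ d → numbered (bitNode i) ≡
                  oneShot (nextBitNegated (triangle d) i d)
  numbered-node i i≤d = begin
    numbered (pair 0 (triangle d + i))  ≡⟨ numbered-pair 0 (triangle d + i) ⟩
    counterBit (triangle d + i)         ≡⟨ cong counterBit (+-comm (triangle d) i) ⟩
    counterBit (i + triangle d)         ≡⟨ cong (λ (i , r) → bitOf i (i + r))
                                                (unpair-diagonal d i (d ∸ i) split) ⟩
    bitOf i (i + (d ∸ i))               ≡⟨ cong (bitOf i) split ⟩
    bitOf i d                           ∎
    where
    open ≡-Reasoning
    split = m+[n∸m]≡n i≤d
    bitOf : ℕ → ℕ → System ℕ
    bitOf i d = oneShot (nextBitNegated (triangle d) i d)

  x-suc : ∀ k i → i ≤ d → x (suc k) i ≡ nextBit d (x k) i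
  x-suc k i i≤d = trans
    (cong (λ s → not (does (manifests? ReEntry marks-decidable (fillR s f))))
          (numbered-node i i≤d))
    (trans (cong not (oneShot-manifests marks-decidable
                       (nextBitNegated (triangle d) i d) f _
                       (eval-nextBit f (triangle d) i d)))
           (not-involutive _))
    where
    f = iterates presentation marks-decidable k

  period : EventualPeriod (λ k → x k d) (2 ^ suc d ∸ 1)
  period = subst (λ n → EventualPeriod (λ k → x k d) (n ∸ 1)) double
    (top-period {v = λ k → binary (x k) (suc d)} {h = pred (2 ^ d)} (binary-false (suc d))
      (λ k → trans (binary-cong (suc d) (λ i i<1+d → x-suc k i (≤-pred i<1+d)))
             (trans (binary-next d (x k))
                    (cong (λ n → increment n (binary (x k) (suc d))) (sym double))))
      (λ k → trans (binary-top (x k) d)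
                   (cong (λ n → not (binary (x k) (suc d) <ᵇ n)) (sym half))))
    where
    half : suc (pred (2 ^ d)) ≡ 2 ^ d
    half = suc-pred (2 ^ d) {{m^n≢0 2 d}}
    double : suc (pred (2 ^ d)) + suc (pred (2 ^ d)) ≡ 2 ^ suc d
    double = trans (cong₂ _+_ half half) (cong (2 ^ d +_) (sym (+-identityʳ (2 ^ d))))

  node-injective : ∀ {i j} → bitNode i ≡ bitNode j → i ≡ j
  node-injective {i} {j} e = +-cancelˡ-≡ (triangle d) i j (cong proj₂
    (trans (sym (unpair-triangle (triangle d + i))) 
    (trans (cong unpair e) (unpair-triangle (triangle d + j)))))

  someClear-gates : ∀ b m {q} → q ∈ gatesE (someClear b m) →
                    ∃[ j ] (j < m × q ≡ triangle (b + j))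
  someClear-gates b (suc m) (here refl) = m , ≤-refl , refl
  someClear-gates b (suc m) (there q∈) =
    let j , j<m , e = someClear-gates b m q∈ in j , m<n⇒m<1+n j<m , e

  gates-someClear : ∀ b m {j} → j < m → triangle (b + j) ∈ gatesE (someClear b m)
  gates-someClear b (suc m) {j} j<1+m with j ≟ m
  ... | yes refl = here refl
  ... | no  j≢m  = there (gates-someClear b m (≤∧≢⇒< (≤-pred j<1+m) j≢m))

  nodes : List ℕ
  nodes = applyUpTo bitNode (suc d)

  asked-nodes : ∀ i → i ≤ d → ∀ {q} → q ∈ Q presentation (bitNode i) →
                ∃[ j ] (j < suc d × q ≡ bitNode j)
  asked-nodes i i≤d {q} q∈
    with ∈-++⁻ (gatesE (nextBitNegated (triangle d) i d))
               (subst (λ s → q ∈ gatesR s) (numbered-node i i≤d) q∈)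
  ... | inj₁ q∈e with ∈-++⁻ (gatesE (someClear (suc (triangle d)) d)) q∈e
  ...   | inj₁ q∈w = let j , j<d , e = someClear-gates _ d q∈w in
          -- The reset test skips bit 0, so its gate number `j` is bit `suc j`.
          suc j , s≤s j<d , trans e (cong triangle (sym (+-suc (triangle d) j)))
  ...   | inj₂ q∈f = [ lower , lower ]′ (∈-++⁻ (gatesE (someClear (triangle d) i) ++ _) q∈f)
    where
    lower : ∀ {q} → q ∈ gatesE (someClear (triangle d) i) ++ bitNode i ∷ [] →
            ∃[ j ] (j < suc d × q ≡ bitNode j)
    lower q∈ with ∈-++⁻ (gatesE (someClear (triangle d) i)) q∈
    ... | inj₁ q∈z         =
      let j , j<i , e = someClear-gates _ i q∈z in j , <-trans j<i (s≤s i≤d) , e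
    ... | inj₂ (here refl) = i , s≤s i≤d , refl

  -- The carry test of the top bit asks every lower bit, so the whole block lies one step from
  -- `bitNode d`.
  top-asks : ∀ j → j < d → bitNode j ∈ Q presentation (bitNode d)
  top-asks j j<d = subst (λ s → bitNode j ∈ gatesR s) (sym (numbered-node d ≤-refl))
    (∈-++⁺ˡ (∈-++⁺ʳ (gatesE (someClear (suc (triangle d)) d))
      (∈-++⁺ˡ (∈-++⁺ˡ (gates-someClear (triangle d) d j<d)))))

  size : HasSize (Q* presentation (bitNode d)) (suc d)
  size = nodes , applyUpTo⁺₁ bitNode (suc d) (λ i<j _ e → <⇒≢ i<j (node-injective e)) ,
         length-applyUpTo bitNode (suc d) , λ q → mk⇔ to from
    where
    to : ∀ {q} → q ∈ nodes → Q* presentation (bitNode d) q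
    to q∈ with ∈-applyUpTo⁻ bitNode q∈
    ... | j , j<1+d , refl with j ≟ d
    ...   | yes refl = base
    ...   | no  j≢d  = step base (top-asks j (≤∧≢⇒< (≤-pred j<1+d) j≢d))
    from : ∀ {q} → Q* presentation (bitNode d) q → q ∈ nodes
    from base = ∈-applyUpTo⁺ bitNode (n<1+n d)
    from (step r∈ q∈) with ∈-applyUpTo⁻ bitNode (from r∈)
    ... | i , i<1+d , refl with asked-nodes i (≤-pred i<1+d) q∈
    ...   | j , j<1+d , refl = ∈-applyUpTo⁺ bitNode j<1+d

theorem5p3 :
    ((D : Domain) (P : Presentation D) (dec : Decidable D) →
      (∀ p n → HasSize (Q* P p) n →
        ∃[ t ] ∃[ π ] (EventualPeriod (λ k → iterates P dec k p) π ×
                       Transient (λ k → iterates P dec k p) π t ×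
                       t + π ≤ 2 ^ n))
      ×
      (Σ[ c ∈ Code tree nat ]
        (∀ p n → HasSize (Q* P p) n →
          ∃[ π ] (EventualPeriod (λ k → iterates P dec k p) π ×
                  ⟦ c ⟧ (Domain.⌜_⌝ D (Presentation.ν P p)) π))))
    ×
    (Σ[ P ∈ Presentation ReEntry ] Σ[ dec ∈ Decidable ReEntry ]
      (∀ N → ∃[ n ] (N ≤ n ×
        (∃[ p ] (HasSize (Q* P p) n ×
                 EventualPeriod (λ k → iterates P dec k p) (2 ^ n ∸ 1))))))
theorem5p3 =
  (λ D P dec → Network.bounded P dec , Network.period-computable P dec) ,
  presentation , marks-decidable , λ N →
  suc N , n≤1+n N , _ , Counter.size N , Counter.period N
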